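{- Let $A=\mathbb{F}_q[t]$ and let $f_1,\ldots,f_r,g\in A$ be non-constant. The number of polynomial functions from $A/f_1A\times\cdots\times A/f_rA$ to $A/gA$ is $$N(f_1,\ldots,f_r;g)=\prod_{\mathbf{k}}q^{\deg\frac{g}{\gcd\left(g,\prod_{i=1}^r\prod_{j=0}^{k_i-1}(a_{k_i}-a_j)\right)}},$$ where the product is over all $\mathbf{k}=(k_1,\ldots,k_r)\in\mathbb{N}^r$ with $0\le k_i<\mu(f_i,g)$ for each $1\le i\le r$.
   Context: Write $\mathbb{F}_q=\{a_0=0,a_1,\ldots,a_{q-1}\}$. For $k\in\mathbb{N}$ with base-$q$ expansion $k=c_0+c_1q+\cdots+c_hq^h$ ($0\le c_s<q$), define $a_k=a_{c_0}+a_{c_1}t+\cdots+a_{c_h}t^h\in A$. Thus $\{a_0,\ldots,a_{q^d-1}\}$ is the set of polynomials of degree $<d$. For each $i$, $A/f_iA$ is identified with the complete residue system of polynomials of degree $<\deg f_i$. A function $f$ from $A/f_1A\times\cdots\times A/f_rA$ to $A/gA$ is a polynomial function if there is $F\in A[x_1,\ldots,x_r]$ with $F(b_1,\ldots,b_r)\equiv f(b_1,\ldots,b_r)\pmod g$ for all $(b_1,\ldots,b_r)$ with $\deg b_i<\deg f_i$ for each $i$. $\lambda(g)$ is the smallest positive integer $k$ such that $g\mid\prod_{j=0}^{k-1}(a_k-a_j)$, and $\mu(f_i,g)=\min(q^{\deg f_i},\lambda(g))$. -}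

module Defs where

open import Algebra.Apartness.Bundles using (HeytingField)
open import Algebra.Bundles using (CommutativeRing; Semiring)
open import Data.Empty using (⊥-elim)
open import Data.Fin.Base as Fin using (Fin; toℕ)
open import Data.Fin.Properties as Fin using (any?)
open import Data.Digit using (toDigits; fromDigits)
open import Data.List.Base as List using (List; []; _∷_)
open import Data.Nat.Base as ℕ using (ℕ; zero; suc; z≤n; s≤s; NonZero)
open import Data.Nat.DivMod using ([m+kn]%n≡m%n; m<n⇒m%n≡m)
import Data.Nat.Properties as ℕ
open import Data.Product.Base using (Σ; ∃; _×_; _,_; proj₁; proj₂)
open import Data.Sum.Base using (_⊎_; inj₁; inj₂)
open import Data.Vec.Functional as Vector using (Vector)
open import Function.Base using (_∘_)
open import Function.Bundles using (Bijection; Func)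
open import Level using (Level; _⊔_; 0ℓ) renaming (suc to lsuc)
open import Relation.Binary.Bundles using (Setoid)
open import Relation.Binary.PropositionalEquality as ≡ using (_≡_)
open import Relation.Nullary.Decidable using (Dec; yes; no; fromWitness; map′; _×-dec_)
open import Relation.Nullary.Negation using (¬_; contradiction)
import Algebra.Definitions.RawMagma as RawMagmaDefs
import Algebra.Definitions.RawSemiring as RawSemiringDefs
import Algebra.Properties.Ring as RingProperties
import Relation.Binary.Reasoning.Setoid as SetoidReasoning

HasCardinality : ∀ {a ℓ} → Setoid a ℓ → ℕ → Set (a ⊔ ℓ)
HasCardinality S n = Bijection (≡.setoid (Fin n)) S

-- A polynomial is a list of coefficients, constant term first; two lists are
-- equal as polynomials when they agree up to trailing zeros.

module Polynomial {c ℓ} (R : CommutativeRing c ℓ) where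

  private
    module R = CommutativeRing R
    open R using (Carrier; _≈_; _+_; _*_; -_; 0#; 1#)
    module RP = RingProperties R.ring
    open SetoidReasoning R.setoid

  Seq : Set c
  Seq = ℕ → Carrier

  Poly : Set c
  Poly = List Carrier

  coeff : Poly → ℕ → Carrier
  coeff []      _       = 0#
  coeff (a ∷ p) zero    = a
  coeff (a ∷ p) (suc k) = coeff p k

  infix 4 _≈ₚ_
  infixl 6 _+ₚ_
  infixl 7 _*ₚ_ _·ₚ_
  infix 8 -ₚ_

  record _≈ₚ_ (p q : Poly) : Set ℓ where
    constructor coeffs≈
    field coeff≈ : ∀ k → coeff p k ≈ coeff q k
  open _≈ₚ_ public

  0ₚ 1ₚ : Poly
  0ₚ = []
  1ₚ = 1# ∷ []

  _+ₚ_ : Poly → Poly → Poly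
  []      +ₚ q       = q
  (a ∷ p) +ₚ []      = a ∷ p
  (a ∷ p) +ₚ (b ∷ q) = (a + b) ∷ (p +ₚ q)

  -ₚ_ : Poly → Poly
  -ₚ_ = List.map -_

  _·ₚ_ : Carrier → Poly → Poly
  a ·ₚ p = List.map (a *_) p

  _*ₚ_ : Poly → Poly → Poly
  []      *ₚ q = []
  (a ∷ p) *ₚ q = (a ·ₚ q) +ₚ (0# ∷ (p *ₚ q))

  coeff-+ : ∀ p q k → coeff (p +ₚ q) k ≈ coeff p k + coeff q k
  coeff-+ []      q       k       = R.sym (R.+-identityˡ _)
  coeff-+ (a ∷ p) []      k       = R.sym (R.+-identityʳ _)
  coeff-+ (a ∷ p) (b ∷ q) zero    = R.refl
  coeff-+ (a ∷ p) (b ∷ q) (suc k) = coeff-+ p q k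

  coeff-neg : ∀ p k → coeff (-ₚ p) k ≈ - coeff p k
  coeff-neg []      k       = R.sym RP.-0#≈0#
  coeff-neg (a ∷ p) zero    = R.refl
  coeff-neg (a ∷ p) (suc k) = coeff-neg p k

  coeff-· : ∀ a p k → coeff (a ·ₚ p) k ≈ a * coeff p k
  coeff-· a []      k       = R.sym (R.zeroʳ a)
  coeff-· a (b ∷ p) zero    = R.refl
  coeff-· a (b ∷ p) (suc k) = coeff-· a p k

  conv : Seq → Seq → Seq
  conv u v zero    = u 0 * v 0
  conv u v (suc k) = u 0 * v (suc k) + conv (u ∘ suc) v k

  conv-cong : ∀ {u u′ v v′} → (∀ k → u k ≈ u′ k) → (∀ k → v k ≈ v′ k) →
              ∀ k → conv u v k ≈ conv u′ v′ k
  conv-cong eq eq′ zero    = R.*-cong (eq 0) (eq′ 0)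
  conv-cong eq eq′ (suc k) =
    R.+-cong (R.*-cong (eq 0) (eq′ (suc k))) (conv-cong (eq ∘ suc) eq′ k)

  conv-0 : ∀ v k → conv (λ _ → 0#) v k ≈ 0#
  conv-0 v zero    = R.zeroˡ _
  conv-0 v (suc k) = R.trans (R.+-cong (R.zeroˡ _) (conv-0 v k)) (R.+-identityˡ 0#)

  conv-· : ∀ a u v k → conv (λ i → a * u i) v k ≈ a * conv u v k
  conv-· a u v zero    = R.*-assoc _ _ _
  conv-· a u v (suc k) =
    R.trans (R.+-cong (R.*-assoc _ _ _) (conv-· a (u ∘ suc) v k)) (R.sym (R.distribˡ _ _ _))

  interchange : ∀ w x y z → (w + x) + (y + z) ≈ (w + y) + (x + z)
  interchange w x y z = begin
    (w + x) + (y + z) ≈⟨ R.+-assoc _ _ _ ⟩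
    w + (x + (y + z)) ≈⟨ R.+-congˡ (R.+-assoc _ _ _) ⟨
    w + ((x + y) + z) ≈⟨ R.+-congˡ (R.+-congʳ (R.+-comm x y)) ⟩
    w + ((y + x) + z) ≈⟨ R.+-congˡ (R.+-assoc _ _ _) ⟩
    w + (y + (x + z)) ≈⟨ R.+-assoc _ _ _ ⟨
    (w + y) + (x + z) ∎

  conv-+ : ∀ u u′ v k → conv (λ i → u i + u′ i) v k ≈ conv u v k + conv u′ v k
  conv-+ u u′ v zero    = R.distribʳ _ _ _
  conv-+ u u′ v (suc k) =
    R.trans (R.+-cong (R.distribʳ _ _ _) (conv-+ (u ∘ suc) (u′ ∘ suc) v k)) (interchange _ _ _ _)

  conv-sucʳ : ∀ u v k → conv u v (suc k) ≈ conv u (v ∘ suc) k + u (suc k) * v 0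
  conv-sucʳ u v zero    = R.refl
  conv-sucʳ u v (suc k) = begin
    u 0 * v (suc (suc k)) + conv (u ∘ suc) v (suc k)
      ≈⟨ R.+-congˡ (conv-sucʳ (u ∘ suc) v k) ⟩
    u 0 * v (suc (suc k)) + (conv (u ∘ suc) (v ∘ suc) k + u (suc (suc k)) * v 0)
      ≈⟨ R.+-assoc _ _ _ ⟨
    conv u (v ∘ suc) (suc k) + u (suc (suc k)) * v 0 ∎

  conv-comm : ∀ u v k → conv u v k ≈ conv v u k
  conv-comm u v zero    = R.*-comm _ _
  conv-comm u v (suc k) = begin
    u 0 * v (suc k) + conv (u ∘ suc) v k ≈⟨ R.+-cong (R.*-comm _ _) (conv-comm (u ∘ suc) v k) ⟩
    v (suc k) * u 0 + conv v (u ∘ suc) k ≈⟨ R.+-comm _ _ ⟩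
    conv v (u ∘ suc) k + v (suc k) * u 0 ≈⟨ conv-sucʳ v u k ⟨
    conv v u (suc k)                     ∎

  conv-assoc : ∀ u v w k → conv (conv u v) w k ≈ conv u (conv v w) k
  conv-assoc u v w zero    = R.*-assoc _ _ _
  conv-assoc u v w (suc k) = begin
    u 0 * v 0 * w (suc k) + conv (λ i → u 0 * v (suc i) + conv (u ∘ suc) v i) w k
      ≈⟨ R.+-congˡ (conv-+ (λ i → u 0 * v (suc i)) (conv (u ∘ suc) v) w k) ⟩
    u 0 * v 0 * w (suc k) + (conv (λ i → u 0 * v (suc i)) w k + conv (conv (u ∘ suc) v) w k)
      ≈⟨ R.+-cong (R.*-assoc _ _ _)
           (R.+-cong (conv-· (u 0) (v ∘ suc) w k) (conv-assoc (u ∘ suc) v w k)) ⟩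
    u 0 * (v 0 * w (suc k)) + (u 0 * conv (v ∘ suc) w k + conv (u ∘ suc) (conv v w) k)
      ≈⟨ R.+-assoc _ _ _ ⟨
    u 0 * (v 0 * w (suc k)) + u 0 * conv (v ∘ suc) w k + conv (u ∘ suc) (conv v w) k
      ≈⟨ R.+-congʳ (R.distribˡ _ _ _) ⟨
    conv u (conv v w) (suc k) ∎

  coeff-* : ∀ p q k → coeff (p *ₚ q) k ≈ conv (coeff p) (coeff q) k
  coeff-* []      q k       = R.sym (conv-0 (coeff q) k)
  coeff-* (a ∷ p) q zero    = begin
    coeff (a ·ₚ q +ₚ (0# ∷ p *ₚ q)) 0 ≈⟨ coeff-+ (a ·ₚ q) _ 0 ⟩
    coeff (a ·ₚ q) 0 + 0#             ≈⟨ R.+-identityʳ _ ⟩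
    coeff (a ·ₚ q) 0                  ≈⟨ coeff-· a q 0 ⟩
    a * coeff q 0                     ∎
  coeff-* (a ∷ p) q (suc k) = begin
    coeff (a ·ₚ q +ₚ (0# ∷ p *ₚ q)) (suc k)  ≈⟨ coeff-+ (a ·ₚ q) _ (suc k) ⟩
    coeff (a ·ₚ q) (suc k) + coeff (p *ₚ q) k ≈⟨ R.+-cong (coeff-· a q (suc k)) (coeff-* p q k) ⟩
    a * coeff q (suc k) + conv (coeff p) (coeff q) k ∎

  via : ∀ {p q} (u : Seq) → (∀ k → coeff p k ≈ u k) → (∀ k → coeff q k ≈ u k) → p ≈ₚ q
  via u eq eq′ = coeffs≈ λ k → R.trans (eq k) (R.sym (eq′ k))

  +ₚ-cong : ∀ {p p′ q q′} → p ≈ₚ p′ → q ≈ₚ q′ → p +ₚ q ≈ₚ p′ +ₚ q′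
  +ₚ-cong {p} {p′} {q} {q′} (coeffs≈ e) (coeffs≈ e′) =
    via (λ k → coeff p k + coeff q k) (coeff-+ p q)
      (λ k → R.trans (coeff-+ p′ q′ k) (R.sym (R.+-cong (e k) (e′ k))))

  *ₚ-cong : ∀ {p p′ q q′} → p ≈ₚ p′ → q ≈ₚ q′ → p *ₚ q ≈ₚ p′ *ₚ q′
  *ₚ-cong {p} {p′} {q} {q′} (coeffs≈ e) (coeffs≈ e′) =
    via (conv (coeff p) (coeff q)) (coeff-* p q)
      (λ k → R.trans (coeff-* p′ q′ k) (R.sym (conv-cong e e′ k)))

  +ₚ-assoc : ∀ p q r → (p +ₚ q) +ₚ r ≈ₚ p +ₚ (q +ₚ r)
  +ₚ-assoc p q r = coeffs≈ λ k → begin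
    coeff ((p +ₚ q) +ₚ r) k             ≈⟨ coeff-+ (p +ₚ q) r k ⟩
    coeff (p +ₚ q) k + coeff r k        ≈⟨ R.+-congʳ (coeff-+ p q k) ⟩
    coeff p k + coeff q k + coeff r k   ≈⟨ R.+-assoc _ _ _ ⟩
    coeff p k + (coeff q k + coeff r k) ≈⟨ R.+-congˡ (coeff-+ q r k) ⟨
    coeff p k + coeff (q +ₚ r) k        ≈⟨ coeff-+ p (q +ₚ r) k ⟨
    coeff (p +ₚ (q +ₚ r)) k             ∎

  +ₚ-comm : ∀ p q → p +ₚ q ≈ₚ q +ₚ p
  +ₚ-comm p q =
    via (λ k → coeff p k + coeff q k) (coeff-+ p q) (λ k → R.trans (coeff-+ q p k) (R.+-comm _ _))

  -ₚ-inverseʳ : ∀ p → p +ₚ (-ₚ p) ≈ₚ 0ₚ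
  -ₚ-inverseʳ p = coeffs≈ λ k →
    R.trans (coeff-+ p (-ₚ p) k) (R.trans (R.+-congˡ (coeff-neg p k)) (R.-‿inverseʳ _))

  *ₚ-comm : ∀ p q → p *ₚ q ≈ₚ q *ₚ p
  *ₚ-comm p q =
    via (conv (coeff p) (coeff q)) (coeff-* p q)
      (λ k → R.trans (coeff-* q p k) (conv-comm (coeff q) (coeff p) k))

  *ₚ-assoc : ∀ p q r → (p *ₚ q) *ₚ r ≈ₚ p *ₚ (q *ₚ r)
  *ₚ-assoc p q r = coeffs≈ λ k → begin
    coeff ((p *ₚ q) *ₚ r) k                      ≈⟨ coeff-* (p *ₚ q) r k ⟩
    conv (coeff (p *ₚ q)) (coeff r) k            ≈⟨ conv-cong (coeff-* p q) (λ _ → R.refl) k ⟩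
    conv (conv (coeff p) (coeff q)) (coeff r) k  ≈⟨ conv-assoc (coeff p) (coeff q) (coeff r) k ⟩
    conv (coeff p) (conv (coeff q) (coeff r)) k  ≈⟨ conv-cong (λ _ → R.refl) (coeff-* q r) k ⟨
    conv (coeff p) (coeff (q *ₚ r)) k            ≈⟨ coeff-* p (q *ₚ r) k ⟨
    coeff (p *ₚ (q *ₚ r)) k                      ∎

  *ₚ-identityˡ : ∀ p → 1ₚ *ₚ p ≈ₚ p
  *ₚ-identityˡ p = coeffs≈ λ k → R.trans (coeff-* 1ₚ p k) (lemma k)
    where
    lemma : ∀ k → conv (coeff 1ₚ) (coeff p) k ≈ coeff p k
    lemma zero    = R.*-identityˡ _
    lemma (suc k) =
      R.trans (R.+-cong (R.*-identityˡ _) (conv-0 (coeff p) k)) (R.+-identityʳ _)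

  *ₚ-distribʳ : ∀ r p q → (p +ₚ q) *ₚ r ≈ₚ p *ₚ r +ₚ q *ₚ r
  *ₚ-distribʳ r p q = coeffs≈ λ k → begin
    coeff ((p +ₚ q) *ₚ r) k                     ≈⟨ coeff-* (p +ₚ q) r k ⟩
    conv (coeff (p +ₚ q)) (coeff r) k           ≈⟨ conv-cong (coeff-+ p q) (λ _ → R.refl) k ⟩
    conv (λ i → coeff p i + coeff q i) (coeff r) k
                                                ≈⟨ conv-+ (coeff p) (coeff q) (coeff r) k ⟩
    conv (coeff p) (coeff r) k + conv (coeff q) (coeff r) k
                                                ≈⟨ R.+-cong (coeff-* p r k) (coeff-* q r k) ⟨
    coeff (p *ₚ r) k + coeff (q *ₚ r) k         ≈⟨ coeff-+ (p *ₚ r) (q *ₚ r) k ⟨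
    coeff (p *ₚ r +ₚ q *ₚ r) k                  ∎

  ≈ₚ-trans : ∀ {p q r} → p ≈ₚ q → q ≈ₚ r → p ≈ₚ r
  ≈ₚ-trans (coeffs≈ e) (coeffs≈ e′) = coeffs≈ λ k → R.trans (e k) (e′ k)

  commutativeRing : CommutativeRing c ℓ
  commutativeRing = record
    { Carrier = Poly ; _≈_ = _≈ₚ_ ; _+_ = _+ₚ_ ; _*_ = _*ₚ_ ; -_ = -ₚ_ ; 0# = 0ₚ ; 1# = 1ₚ
    ; isCommutativeRing = record
      { isRing = record
        { +-isAbelianGroup = record
          { isGroup = record
            { isMonoid = record
              { isSemigroup = record
                { isMagma = record
                  { isEquivalence = record
                    { refl  = coeffs≈ λ _ → R.refl
                    ; sym   = λ (coeffs≈ e) → coeffs≈ λ k → R.sym (e k)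
                    ; trans = ≈ₚ-trans
                    }
                  ; ∙-cong = +ₚ-cong
                  }
                ; assoc = +ₚ-assoc
                }
              ; identity = (λ _ → coeffs≈ λ _ → R.refl) , λ p → +ₚ-comm p 0ₚ
              }
            ; inverse = (λ p → ≈ₚ-trans (+ₚ-comm (-ₚ p) p) (-ₚ-inverseʳ p)) , -ₚ-inverseʳ
            ; ⁻¹-cong = λ {p} {q} (coeffs≈ e) →
                via (λ k → - coeff p k) (coeff-neg p)
                  (λ k → R.trans (coeff-neg q k) (R.-‿cong (R.sym (e k))))
            }
          ; comm = +ₚ-comm
          }
        ; *-cong     = *ₚ-cong
        ; *-assoc    = *ₚ-assoc
        ; *-identity = *ₚ-identityˡ , λ p → ≈ₚ-trans (*ₚ-comm p 1ₚ) (*ₚ-identityˡ p)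
        ; distrib    =
            (λ p q r → ≈ₚ-trans (*ₚ-comm p (q +ₚ r))
                         (≈ₚ-trans (*ₚ-distribʳ p q r) (+ₚ-cong (*ₚ-comm q p) (*ₚ-comm r p))))
            , *ₚ-distribʳ
        }
      ; *-comm = *ₚ-comm
      }
    }

module Divisibility {c ℓ} (R : CommutativeRing c ℓ) where

  open CommutativeRing R
  open RingProperties ring
  open RawMagmaDefs *-rawMagma public using (_∣_; module _∣ʳ_; _,_)
  open SetoidReasoning setoid

  ∣-resp : ∀ {d x y} → x ≈ y → d ∣ x → d ∣ y
  ∣-resp x≈y (u , eq) = u , trans eq x≈y

  ∣-+ : ∀ {d x y} → d ∣ x → d ∣ y → d ∣ x + y
  ∣-+ (u , eq) (v , eq′) = u + v , trans (distribʳ _ u v) (+-cong eq eq′)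

  ∣-neg : ∀ {d x} → d ∣ x → d ∣ - x
  ∣-neg (u , eq) = - u , trans (sym (-‿distribˡ-* u _)) (-‿cong eq)

  ∣-* : ∀ {d x} y → d ∣ x → d ∣ y * x
  ∣-* y (u , eq) = y * u , trans (*-assoc y u _) (*-congˡ eq)

  shift-remainder : ∀ w u r → u + r ≈ (w + u) + (r - w)
  shift-remainder w u r = begin
    u + r             ≈⟨ +-congˡ (+-identityʳ r) ⟨
    u + (r + 0#)      ≈⟨ +-congˡ (+-congˡ (-‿inverseˡ w)) ⟨
    u + (r + (- w + w)) ≈⟨ +-congˡ (+-assoc r (- w) w) ⟨
    u + (r - w + w)   ≈⟨ +-congˡ (+-comm (r - w) w) ⟩
    u + (w + (r - w)) ≈⟨ +-assoc u w (r - w) ⟨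
    u + w + (r - w)   ≈⟨ +-congʳ (+-comm u w) ⟩
    w + u + (r - w)   ∎

  remainder : ∀ {p u r} → p ≈ u + r → p - u ≈ r
  remainder {p} {u} {r} eq = begin
    p - u           ≈⟨ +-comm p (- u) ⟩
    - u + p         ≈⟨ +-congˡ eq ⟩
    - u + (u + r)   ≈⟨ +-assoc (- u) u r ⟨
    - u + u + r     ≈⟨ +-congʳ (-‿inverseˡ u) ⟩
    0# + r          ≈⟨ +-identityˡ r ⟩
    r               ∎

  infix 4 _≡_mod_
  _≡_mod_ : Carrier → Carrier → Carrier → Set (c ⊔ ℓ)
  x ≡ y mod g = g ∣ x - y

  quotientSetoid : Carrier → Setoid c (c ⊔ ℓ)
  quotientSetoid g = record
    { Carrier       = Carrier
    ; _≈_           = λ x y → x ≡ y mod g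
    ; isEquivalence = record
      { refl  = λ {x} → 0# , trans (zeroˡ g) (sym (-‿inverseʳ x))
      ; sym   = λ {x} {y} g∣ → ∣-resp (swap x y) (∣-neg g∣)
      ; trans = λ {x} {y} {z} g∣ g∣′ → ∣-resp (telescope x y z) (∣-+ g∣ g∣′)
      }
    }
    where
    swap : ∀ x y → - (x - y) ≈ y - x
    swap x y = begin
      - (x - y)     ≈⟨ -‿anti-homo-+ x (- y) ⟩
      - - y + - x   ≈⟨ +-congʳ (-‿involutive y) ⟩
      y - x         ∎

    telescope : ∀ x y z → (x - y) + (y - z) ≈ x - z
    telescope x y z = begin
      (x - y) + (y - z)     ≈⟨ +-assoc x (- y) (y - z) ⟩
      x + (- y + (y - z))   ≈⟨ +-congˡ (+-assoc (- y) y (- z)) ⟨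
      x + ((- y + y) - z)   ≈⟨ +-congˡ (+-congʳ (-‿inverseˡ y)) ⟩
      x + (0# - z)          ≈⟨ +-congˡ (+-identityˡ (- z)) ⟩
      x - z                 ∎

  record IsGCD (x y d : Carrier) : Set (c ⊔ ℓ) where
    field
      d∣x      : d ∣ x
      d∣y      : d ∣ y
      greatest : ∀ {e} → e ∣ x → e ∣ y → e ∣ d

  gcd-zero : ∀ {x y} → y ≈ 0# → IsGCD x y x
  gcd-zero {x} y≈0 = record
    { d∣x      = 1# , *-identityˡ x
    ; d∣y      = 0# , trans (zeroˡ x) (sym y≈0)
    ; greatest = λ e∣x _ → e∣x
    }

  gcd-step : ∀ {x y r d} s → x ≈ s * y + r → IsGCD y r d → IsGCD x y d
  gcd-step s x≈ isGCD = record
    { d∣x      = ∣-resp (sym x≈) (∣-+ (∣-* s d∣x) d∣y)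
    ; d∣y      = d∣x
    ; greatest = λ e∣x e∣y →
        greatest e∣y (∣-resp (remainder x≈) (∣-+ e∣x (∣-neg (∣-* s e∣y))))
    }
    where open IsGCD isGCD

-- A field with an enumeration of its finitely many elements, starting with 0;
-- equality is then decidable, and _#_ amounts to its negation.

record FiniteField (c ℓ₁ ℓ₂ : Level) : Set (lsuc (c ⊔ ℓ₁ ⊔ ℓ₂)) where
  field
    heytingField : HeytingField c ℓ₁ ℓ₂

  open HeytingField heytingField public

  field
    order       : ℕ
    enumeration : Bijection (≡.setoid (Fin order)) setoid

  open Bijection enumeration public using () renaming (to to element)

  field
    element-0 : ∀ i → toℕ i ≡ 0 → element i ≈ 0#

  commutativeRing : CommutativeRing c ℓ₁
  commutativeRing = record { isCommutativeRing = isCommutativeRing }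

module FiniteFieldPolynomials {c ℓ₁ ℓ₂} (F : FiniteField c ℓ₁ ℓ₂) where

  module F where
    open FiniteField F public
    open RingProperties (CommutativeRing.ring commutativeRing) public

  module P = Polynomial F.commutativeRing

  open P public using (coeff; coeffs≈; coeff≈)

  q : ℕ
  q = F.order

  F[t] : CommutativeRing c ℓ₁
  F[t] = P.commutativeRing

  open CommutativeRing F[t] public
    using (_≈_; _+_; _*_; -_; _-_; 0#; 1#) renaming (Carrier to A)
  private
    module A where
      open CommutativeRing F[t] public
      open RingProperties ring public
  open Divisibility F[t] public
  open RawSemiringDefs (Semiring.rawSemiring A.semiring) public
    using (_^_) renaming (product to ∏)

  index : F.Carrier → Fin q
  index x = proj₁ (Bijection.surjective F.enumeration x)

  element-index : ∀ x → F.element (index x) F.≈ x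
  element-index x = proj₂ (Bijection.surjective F.enumeration x) ≡.refl

  1≉0 : ¬ F.1# F.≈ F.0#
  1≉0 1≈0 = F.#-irrefl F.refl
    (F.invertible⇒# {F.0#} {F.0#} (F.0# , collapse (F.zeroˡ _) , collapse (F.zeroʳ _)))
    where
    collapse : ∀ {x} → x F.≈ F.0# → x F.≈ F.1#
    collapse x≈0 = F.trans x≈0 (F.sym 1≈0)

  2≤q : 2 ℕ.≤ q
  2≤q = distinct (index F.1#) (index F.0#) λ eq →
    1≉0 (F.trans (F.sym (element-index F.1#))
           (F.trans (F.reflexive (≡.cong F.element eq)) (element-index F.0#)))
    where
    distinct : ∀ {n} (i j : Fin n) → ¬ i ≡ j → 2 ℕ.≤ n
    distinct {suc zero}    Fin.zero Fin.zero i≢j = contradiction ≡.refl i≢j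
    distinct {suc (suc n)} _        _        _   = s≤s (s≤s z≤n)

  digits : ℕ → List (Fin q)
  digits k = proj₁ (toDigits q {fromWitness 2≤q} k)

  fromDigits-digits : ∀ k → fromDigits (digits k) ≡ k
  fromDigits-digits k = proj₂ (toDigits q {fromWitness 2≤q} k)

  a : ℕ → A
  a k = List.map F.element (digits k)

  private
    instance
      q≢0 : NonZero q
      q≢0 = ℕ.>-nonZero (ℕ.≤-trans (s≤s z≤n) 2≤q)

  ∷-cong : ∀ {x y} {p p′ : A} → x F.≈ y → p ≈ p′ → (x ∷ p) ≈ (y ∷ p′)
  ∷-cong x≈y p≈p′ = coeffs≈ λ { zero → x≈y ; (suc k) → coeff≈ p≈p′ k }

  elements-0 : ∀ ds → fromDigits ds ≡ 0 → List.map F.element ds ≈ 0#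
  elements-0 []       _  = A.refl
  elements-0 (d ∷ ds) eq = coeffs≈ λ
    { zero    → F.element-0 d (ℕ.m+n≡0⇒m≡0 (toℕ d) eq)
    ; (suc k) → coeff≈ (elements-0 ds (ℕ.m*n≡0⇒m≡0 _ q (ℕ.m+n≡0⇒n≡0 (toℕ d) eq))) k
    }

  elements-unique : ∀ ds es → fromDigits ds ≡ fromDigits es →
                    List.map F.element ds ≈ List.map F.element es
  elements-unique []       es       eq = A.sym (elements-0 es (≡.sym eq))
  elements-unique (d ∷ ds) []       eq = elements-0 (d ∷ ds) eq
  elements-unique (d ∷ ds) (e ∷ es) eq =
    ∷-cong (F.reflexive (≡.cong F.element (Fin.toℕ-injective d≡e)))
           (elements-unique ds es (ℕ.*-cancelʳ-≡ (fromDigits ds) (fromDigits es) q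
             (ℕ.+-cancelˡ-≡ (toℕ d) _ _ (≡.trans eq (≡.cong (ℕ._+ fromDigits es ℕ.* q) (≡.sym d≡e))))))
    where
    low : ∀ (i : Fin q) m → (toℕ i ℕ.+ m ℕ.* q) ℕ.% q ≡ toℕ i
    low i m = ≡.trans ([m+kn]%n≡m%n (toℕ i) m q) (m<n⇒m%n≡m (Fin.toℕ<n i))

    d≡e : toℕ d ≡ toℕ e
    d≡e = ≡.trans (≡.sym (low d (fromDigits ds))) (≡.trans (≡.cong (ℕ._% q) eq) (low e (fromDigits es)))

  a-0 : a 0 ≈ 0#
  a-0 = elements-0 (digits 0) (fromDigits-digits 0)

  number : A → ℕ
  number p = fromDigits (List.map index p)

  a-number : ∀ p → a (number p) ≈ p
  a-number p = A.trans (elements-unique _ _ (fromDigits-digits (number p))) (elements-index p)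
    where
    elements-index : ∀ p → List.map F.element (List.map index p) ≈ p
    elements-index []      = A.refl
    elements-index (x ∷ p) = ∷-cong (element-index x) (elements-index p)

  infix 4 _≟_
  _≟_ : ∀ x y → Dec (x F.≈ y)
  x ≟ y = map′
    (λ eq → F.trans (F.sym (element-index x))
              (F.trans (F.reflexive (≡.cong F.element eq)) (element-index y)))
    (λ eq → Bijection.injective F.enumeration
              (F.trans (element-index x) (F.trans eq (F.sym (element-index y)))))
    (index x Fin.≟ index y)

  _≈0? : ∀ (p : A) → Dec (p ≈ 0#)
  []      ≈0? = yes A.refl
  (x ∷ p) ≈0? = map′
    (λ (x≈0 , p≈0) → coeffs≈ λ { zero → x≈0 ; (suc k) → coeff≈ p≈0 k })
    (λ e → coeff≈ e 0 , coeffs≈ (coeff≈ e ∘ suc))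
    (x ≟ F.0# ×-dec p ≈0?)

  -- deg 0 = 0 by convention; in particular deg b < n includes b = 0 when n > 0.
  deg : A → ℕ
  deg []      = 0
  deg (_ ∷ p) with p ≈0?
  ... | yes _ = 0
  ... | no  _ = suc (deg p)

  NonConstant : A → Set
  NonConstant p = 0 ℕ.< deg p

  coeff-deg : ∀ p → ¬ p ≈ 0# → ¬ coeff p (deg p) F.≈ F.0#
  coeff-deg []      p≉0 = contradiction A.refl p≉0
  coeff-deg (x ∷ p) p≉0 with p ≈0?
  ... | yes p≈0 = λ x≈0 → p≉0 (coeffs≈ λ { zero → x≈0 ; (suc k) → coeff≈ p≈0 k })
  ... | no  p≉0 = coeff-deg p p≉0

  VanishesFrom : ℕ → A → Set ℓ₁
  VanishesFrom n p = ∀ k → n ℕ.≤ k → coeff p k F.≈ F.0#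

  vanishes-above-deg : ∀ p → VanishesFrom (suc (deg p)) p
  vanishes-above-deg []      k       _     = F.refl
  vanishes-above-deg (x ∷ p) (suc k) d<k with p ≈0?
  ... | yes p≈0 = coeff≈ p≈0 k
  ... | no  _   = vanishes-above-deg p k (ℕ.≤-pred d<k)

  NonConstant⇒≉0 : ∀ p → NonConstant p → ¬ p ≈ 0#
  NonConstant⇒≉0 (x ∷ p) nc x∷p≈0 with p ≈0?
  NonConstant⇒≉0 (x ∷ p) () x∷p≈0 | yes _
  ... | no p≉0 = p≉0 (coeffs≈ (coeff≈ x∷p≈0 ∘ suc))

  inverse : ∀ x → ¬ x F.≈ F.0# → ∃ λ y → y F.* x F.≈ F.1#
  inverse x x≉0 with any? (λ i → F.element i F.* x ≟ F.1#)
  ... | yes (i , eq) = F.element i , eq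
  ... | no  none     = contradiction (proj₁ (F.tight x F.0#) ¬x#0) x≉0
    where
    x-0≈x : x F.- F.0# F.≈ x
    x-0≈x = F.trans (F.+-congˡ F.-0#≈0#) (F.+-identityʳ x)

    ¬x#0 : ¬ x F.# F.0#
    ¬x#0 x#0 with F.#⇒invertible x#0
    ... | y , eq , _ =
      none (index y , F.trans (F.*-cong (element-index y) (F.sym x-0≈x)) eq)

  HasDegree : A → ℕ → Set ℓ₁
  HasDegree p n = (¬ coeff p n F.≈ F.0#) × VanishesFrom (suc n) p

  deg-HasDegree : ∀ p → ¬ p ≈ 0# → HasDegree p (deg p)
  deg-HasDegree p p≉0 = coeff-deg p p≉0 , vanishes-above-deg p

  const-* : ∀ x p k → coeff ((x ∷ []) * p) k F.≈ x F.* coeff p k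
  const-* x p k = F.trans (P.coeff-+ (x P.·ₚ p) (F.0# ∷ []) k)
    (F.trans (F.+-cong (P.coeff-· x p k) (zeros k)) (F.+-identityʳ _))
    where
    zeros : ∀ k → coeff (F.0# ∷ []) k F.≈ F.0#
    zeros zero    = F.refl
    zeros (suc k) = F.refl

  ∷-* : ∀ x u p → (x ∷ u) * p ≈ (x ∷ []) * p + (F.0# ∷ (u * p))
  ∷-* x u p = A.+-congʳ (A.sym (A.trans (A.+-congˡ 0∷0) (A.+-identityʳ (x P.·ₚ p))))
    where
    0∷0 : (F.0# ∷ []) ≈ 0#
    0∷0 = coeffs≈ λ { zero → F.refl ; (suc k) → F.refl }

  Division : A → ℕ → A → Set (c ⊔ ℓ₁)
  Division g n p = ∃ λ s → ∃ λ r → p ≈ s * g + r × VanishesFrom n r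

  divide : ∀ g n → HasDegree g n → ∀ p → Division g n p
  divide g n g-deg         []      = 0# , 0# , A.refl , λ _ _ → F.refl
  divide g n g-deg@(l≉0 , above) (x ∷ p) with divide g n g-deg p | inverse (coeff g n) l≉0
  ... | s , r , p≈ , r-deg | y , yl≈1 = (z ∷ s) , (r′ - w * g) , eq , vanish
    where
    r′ w : A
    r′ = x ∷ r
    z  = coeff r′ n F.* y
    w  = z ∷ []

    open SetoidReasoning A.setoid

    eq : (x ∷ p) ≈ (z ∷ s) * g + (r′ - w * g)
    eq = begin
      x ∷ p                                  ≈⟨ ∷-cong (F.sym (F.+-identityˡ x)) p≈ ⟩
      (F.0# ∷ (s * g)) + r′                  ≈⟨ shift-remainder (w * g) (F.0# ∷ (s * g)) r′ ⟩
      w * g + (F.0# ∷ (s * g)) + (r′ - w * g) ≈⟨ A.+-congʳ {r′ - w * g} (∷-* z s g) ⟨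
      (z ∷ s) * g + (r′ - w * g)             ∎

    r′-above : VanishesFrom (suc n) r′
    r′-above (suc k) n<k = r-deg k (ℕ.≤-pred n<k)

    coeff-rem : ∀ k → coeff (r′ - w * g) k F.≈ coeff r′ k F.- z F.* coeff g k
    coeff-rem k = F.trans (P.coeff-+ r′ (- (w * g)) k)
      (F.+-congˡ (F.trans (P.coeff-neg (w * g) k) (F.-‿cong (const-* z g k))))

    vanish : VanishesFrom n (r′ - w * g)
    vanish k n≤k with ℕ.m≤n⇒m<n∨m≡n n≤k
    ... | inj₁ n<k = F.trans (coeff-rem k) (F.trans
      (F.+-cong (r′-above k n<k)
        (F.trans (F.-‿cong (F.trans (F.*-congˡ (above k n<k)) (F.zeroʳ z))) F.-0#≈0#))
      (F.+-identityˡ F.0#))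
    ... | inj₂ ≡.refl = F.trans (coeff-rem n) (F.trans
      (F.+-congˡ (F.-‿cong (F.trans (F.*-assoc _ y _)
        (F.trans (F.*-congˡ yl≈1) (F.*-identityʳ _)))))
      (F.-‿inverseʳ _))

  -- Any multiple u g of a polynomial g of degree n with deg (u g) < n vanishes.
  small-multiple : ∀ g n → HasDegree g n → ∀ u → VanishesFrom n (u * g) → u ≈ 0#
  small-multiple g n g-deg []      _     = A.refl
  small-multiple g n g-deg@(l≉0 , above) (x ∷ u) small = coeffs≈ λ
    { zero → x≈0 ; (suc k) → coeff≈ u≈0 k }
    where
    split : ∀ k → coeff ((x ∷ u) * g) k F.≈ x F.* coeff g k F.+ coeff (F.0# ∷ (u * g)) k
    split k = F.trans (P.coeff-+ (x P.·ₚ g) (F.0# ∷ (u * g)) k) (F.+-congʳ (P.coeff-· x g k))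

    u≈0 : u ≈ 0#
    u≈0 = small-multiple g n g-deg u λ k n≤k →
      F.trans (F.sym (F.+-identityˡ _)) (F.trans
        (F.+-congʳ (F.sym (F.trans (F.*-congˡ (above (suc k) (s≤s n≤k))) (F.zeroʳ x))))
        (F.trans (F.sym (split (suc k))) (small (suc k) (ℕ.m≤n⇒m≤1+n n≤k))))

    shifted : ∀ k → coeff (F.0# ∷ (u * g)) k F.≈ F.0#
    shifted zero    = F.refl
    shifted (suc k) = coeff≈ (A.trans (A.*-congʳ u≈0) (A.zeroˡ g)) k

    xl≈0 : x F.* coeff g n F.≈ F.0#
    xl≈0 = F.trans (F.sym (F.+-identityʳ _)) (F.trans (F.+-congˡ (F.sym (shifted n)))
      (F.trans (F.sym (split n)) (small n ℕ.≤-refl)))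

    x≈0 : x F.≈ F.0#
    x≈0 with inverse (coeff g n) l≉0
    ... | y , yl≈1 = F.trans (F.sym (F.*-identityʳ x)) (F.trans
      (F.*-congˡ (F.trans (F.sym yl≈1) (F.*-comm y _)))
      (F.trans (F.sym (F.*-assoc x _ y)) (F.trans (F.*-congʳ xl≈0) (F.zeroˡ y))))

  divides? : ∀ g → ¬ g ≈ 0# → ∀ p → Dec (g ∣ p)
  divides? g g≉0 p with divide g (deg g) (deg-HasDegree g g≉0) p
  ... | s , r , p≈ , r-deg with r ≈0?
  ... | yes r≈0 = yes (s , A.sym (A.trans p≈ (A.trans (A.+-congˡ r≈0) (A.+-identityʳ (s * g)))))
  ... | no  r≉0 = no λ g∣p → r≉0 (g∣r⇒r≈0 (∣-resp (remainder {p} {s * g} p≈)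
                    (∣-+ g∣p (∣-neg {g} {s * g} (s , A.refl)))))
    where
    g∣r⇒r≈0 : g ∣ r → r ≈ 0#
    g∣r⇒r≈0 (u , ug≈r) = A.trans (A.sym ug≈r) (A.trans (A.*-congʳ
      (small-multiple g (deg g) (deg-HasDegree g g≉0) u
        λ k n≤k → F.trans (coeff≈ ug≈r k) (r-deg k n≤k))) (A.zeroˡ g))

  gcd-exists : ∀ x y → ∃ (IsGCD x y)
  gcd-exists x y = euclid (suc (deg y)) x y (vanishes-above-deg y)
    where
    euclid : ∀ n x y → VanishesFrom n y → ∃ (IsGCD x y)
    euclid zero x y y-van = x , gcd-zero (coeffs≈ λ k → y-van k z≤n)
    euclid (suc n) x y y-van with coeff y n ≟ F.0#
    ... | yes l≈0 = euclid n x y λ k n≤k → vanish k (ℕ.m≤n⇒m<n∨m≡n n≤k)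
      where
      vanish : ∀ k → _ → coeff y k F.≈ F.0#
      vanish k (inj₁ n<k)    = y-van k n<k
      vanish k (inj₂ ≡.refl) = l≈0
    ... | no  l≉0 with divide y n (l≉0 , y-van) x
    ... | s , r , x≈ , r-deg with euclid n y r r-deg
    ... | d , isGCD = d , gcd-step s x≈ isGCD

  gcd : A → A → A
  gcd x y = proj₁ (gcd-exists x y)

  gcd-isGCD : ∀ x y → IsGCD x y (gcd x y)
  gcd-isGCD x y = proj₂ (gcd-exists x y)

  -- x /gcd y is x divided by gcd x y; for x ≉ 0 its degree does not depend on
  -- which associate gcd x y is.
  infixl 7 _/gcd_
  _/gcd_ : A → A → A
  x /gcd y = _∣ʳ_.quotient (IsGCD.d∣x (gcd-isGCD x y))

  factorial : ℕ → A
  factorial k = ∏ {k} λ j → a k - a (toℕ j)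

  record IsLambda (g : A) (k : ℕ) : Set (c ⊔ ℓ₁) where
    field
      positive : 0 ℕ.< k
      divides  : g ∣ factorial k
      least    : ∀ {m} → 0 ℕ.< m → g ∣ factorial m → k ℕ.≤ m

  lambda-exists : ∀ g → NonConstant g → ∃ (IsLambda g)
  lambda-exists g g-nc = search (number g) 0<number g∣factorial
    where
    g≉0 : ¬ g ≈ 0#
    g≉0 = NonConstant⇒≉0 g g-nc

    0<number : 0 ℕ.< number g
    0<number = ℕ.n≢0⇒n>0 λ eq →
      g≉0 (A.trans (A.sym (a-number g)) (A.trans (A.reflexive (≡.cong a eq)) a-0))

    -- The factor for j = 0 is g itself.
    g∣factorial : g ∣ factorial (number g)
    g∣factorial = lemma (number g) 0<number (a-number g)
      where
      lemma : ∀ k → 0 ℕ.< k → a k ≈ g → g ∣ factorial k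
      lemma (suc k) _ eq = rest , A.trans (A.*-comm rest g) (A.*-congʳ (A.sym first))
        where
        rest : A
        rest = ∏ {k} λ j → a (suc k) - a (toℕ (Fin.suc j))

        first : a (suc k) - a 0 ≈ g
        first = A.trans (A.+-cong eq (A.trans (A.-‿cong a-0) A.-0#≈0#)) (A.+-identityʳ g)

    Good : ℕ → Set (c ⊔ ℓ₁)
    Good k = 0 ℕ.< k × g ∣ factorial k

    good? : ∀ k → Dec (Good k)
    good? k = 0 ℕ.<? k ×-dec divides? g g≉0 (factorial k)

    below : ∀ n → ∃ (IsLambda g) ⊎ (∀ k → k ℕ.< n → ¬ Good k)
    below zero    = inj₂ λ _ ()
    below (suc n) with below n
    ... | inj₁ found = inj₁ found
    ... | inj₂ none with good? n
    ... | yes (0<n , g∣n) = inj₁ (n , record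
      { positive = 0<n
      ; divides  = g∣n
      ; least    = λ {m} 0<m g∣m → ℕ.≮⇒≥ λ m<n → none m m<n (0<m , g∣m)
      })
    ... | no  bad = inj₂ λ k k<1+n → case k (ℕ.m≤n⇒m<n∨m≡n (ℕ.≤-pred k<1+n))
      where
      case : ∀ k → k ℕ.< n ⊎ k ≡ n → ¬ Good k
      case k (inj₁ k<n)    = none k k<n
      case k (inj₂ ≡.refl) = bad

    search : ∀ n → 0 ℕ.< n → g ∣ factorial n → ∃ (IsLambda g)
    search n 0<n g∣n with below (suc n)
    ... | inj₁ found = found
    ... | inj₂ none  = contradiction (0<n , g∣n) (none n ℕ.≤-refl)

  lambda : ∀ g → NonConstant g → ℕ
  lambda g g-nc = proj₁ (lambda-exists g g-nc)

  lambda-isLambda : ∀ g g-nc → IsLambda g (lambda g g-nc)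
  lambda-isLambda g g-nc = proj₂ (lambda-exists g g-nc)

  μ : A → ∀ g → NonConstant g → ℕ
  μ f g g-nc = (q ℕ.^ deg f) ℕ.⊓ lambda g g-nc

  -- A/fA, as the complete residue system of polynomials of degree < deg f
  Residue : A → Setoid c ℓ₁
  Residue f = record
    { Carrier       = Σ A λ b → deg b ℕ.< deg f
    ; _≈_           = λ (b , _) (b′ , _) → b ≈ b′
    ; isEquivalence = record { refl = A.refl ; sym = A.sym ; trans = A.trans }
    }

  Residues : ∀ {r} → Vector A r → Setoid c ℓ₁
  Residues f = record
    { Carrier       = ∀ i → Setoid.Carrier (Residue (f i))
    ; _≈_           = λ b b′ → ∀ i → Setoid._≈_ (Residue (f i)) (b i) (b′ i)
    ; isEquivalence = record
      { refl  = λ _ → A.refl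
      ; sym   = λ eq i → A.sym (eq i)
      ; trans = λ eq eq′ i → A.trans (eq i) (eq′ i)
      }
    }

  A/ : A → Setoid c (c ⊔ ℓ₁)
  A/ = quotientSetoid

  -- An element of A[x₁, …, xᵣ] is written as a finite sum of terms
  -- u x₁^e₁ ⋯ xᵣ^eᵣ.  The same polynomial can be written in several ways.
  MvPoly : ℕ → Set c
  MvPoly r = List (A × Vector ℕ r)

  eval : ∀ {r} → MvPoly r → Vector A r → A
  eval P b = List.foldr _+_ 0# (List.map (λ (u , e) → u * ∏ λ i → b i ^ e i) P)

  IsPolynomial : ∀ {r} (f : Vector A r) (g : A) → Func (Residues f) (A/ g) → Set (c ⊔ ℓ₁)
  IsPolynomial {r} f g φ =
    ∃ λ (P : MvPoly r) → ∀ b → eval P (proj₁ ∘ b) ≡ Func.to φ b mod g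

  PolynomialFunctions : ∀ {r} (f : Vector A r) (g : A) → Setoid (c ⊔ ℓ₁) (c ⊔ ℓ₁)
  PolynomialFunctions f g = record
    { Carrier       = Σ (Func (Residues f) (A/ g)) (IsPolynomial f g)
    ; _≈_           = λ (φ , _) (ψ , _) → ∀ b → Func.to φ b ≡ Func.to ψ b mod g
    ; isEquivalence = record
      { refl  = λ {(φ , _)} b → A/g.refl {Func.to φ b}
      ; sym   = λ {(φ , _)} {(ψ , _)} eq b → A/g.sym {Func.to φ b} {Func.to ψ b} (eq b)
      ; trans = λ {(φ , _)} {(ψ , _)} {(χ , _)} eq eq′ b →
          A/g.trans {Func.to φ b} {Func.to ψ b} {Func.to χ b} (eq b) (eq′ b)
      }
    }
    where module A/g = Setoid (A/ g)

-- All k with k i < m i for each i.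
box : ∀ {r} → Vector ℕ r → List (Vector ℕ r)
box {zero}  m = Vector.[] ∷ []
box {suc r} m =
  List.cartesianProductWith Vector._∷_ (List.upTo (Vector.head m)) (box (Vector.tail m))

module Submission where

-- The monic polynomials newton k x = (x - a₀)⋯(x - aₖ₋₁) form a basis, so every polynomial
-- function is a combination Σ cₖ ∏ᵢ newton (kᵢ) (xᵢ).  The key fact is that newton k (aₖ)
-- divides newton k x for all x.  Hence the terms outside the box vanish modulo g, cₖ matters
-- only modulo g / gcd(g, ∏ᵢ newton (kᵢ) (a_kᵢ)), and evaluating at the points (a_kᵢ)ᵢ in
-- lexicographic order recovers these residues.
--
-- The key fact needs no prime factorisation: Carlitz's additive functions E s, normalised by
-- E s (t ^ s) = 1, satisfy (t ^ qˢ⁺¹ - t) E (s + 1) z = E s z ^ q - E s z = ∏_{c ∈ 𝔽} (E s z - c).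
-- Grouping the factors of ∏_{j < k} E s (t ^ s (x - aⱼ)) by the last base-q digit of j
-- therefore reduces its divisibility for (s, k) to that for (s + 1, ⌊k / q⌋).

open import Defs
open import Algebra.Bundles using (CommutativeRing; Semiring)
import Algebra.Definitions.RawSemiring as RawSemiringDefs
import Algebra.Properties.AbelianGroup
import Algebra.Properties.CommutativeMonoid.Sum
import Algebra.Properties.CommutativeSemigroup.Divisibility
import Algebra.Properties.CommutativeSemiring.Exp
import Algebra.Properties.Ring
import Algebra.Properties.Semiring.Mult.TCOptimised
import Algebra.Solver.Ring
open import Algebra.Solver.Ring.AlmostCommutativeRing using (fromCommutativeRing; _-Raw-AlmostCommutative⟶_)
open import Data.Digit using (fromDigits)
open import Data.Fin using (toℕ)
open import Data.Fin.Base as Fin using (Fin; combine; fromℕ; fromℕ<; inject₁; remQuot)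
open import Data.Fin.Permutation as Permutation using (Permutation; _⟨$⟩ʳ_; permutation)
open import Data.Fin.Properties as Fin using (combine-remQuot; remQuot-combine; toℕ-fromℕ; toℕ-fromℕ<; toℕ-inject₁)
open import Data.Integer.Base as ℤ using (ℤ; -[1+_]; +[1+_]; +0; 0ℤ; 1ℤ; +-*-rawRing)
import Data.Integer.Properties as ℤ
open import Data.List using (map)
open import Data.List.Base as List using (List; []; _∷_; _++_; cartesianProductWith; length; upTo)
open import Data.List.Membership.Propositional using (_∈_)
open import Data.List.Membership.Propositional.Properties using (∈-upTo⁺)
open import Data.List.Relation.Unary.All as All using (All; []; _∷_)
import Data.List.Relation.Unary.All.Properties as All
open import Data.List.Relation.Unary.AllPairs as AllPairs using (AllPairs; []; _∷_)
import Data.List.Relation.Unary.AllPairs.Properties as AllPairs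
open import Data.List.Relation.Unary.Any using (here; there)
import Data.Maybe.Base as Maybe
open import Data.Nat as ℕ using (ℕ)
open import Data.Nat.Base using (zero; suc; z≤n; s≤s; NonZero)
open import Data.Nat.DivMod using (m≡m%n+[m/n]*n; m%n<n; m/n<m)
open import Data.Nat.Induction using (<-rec)
open import Data.Nat.ListAction using (product)
import Data.Nat.Properties as ℕ
open import Data.Product.Base using (∃; _×_; _,_; proj₁; proj₂)
open import Data.Sum.Base using (_⊎_; inj₁; inj₂)
import Data.Vec.Functional as Vector
open import Data.Vec.Functional using (Vector)
open import Function.Base using (_∘_; id)
open import Function.Bundles using (Bijection)
open import Level using (_⊔_)
open import Relation.Binary.Bundles using (Setoid)
open import Relation.Binary.PropositionalEquality as ≡ using (_≡_)
import Relation.Binary.Reasoning.Setoid as SetoidReasoning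
open import Relation.Nullary.Decidable using (yes; no; dec⇒maybe)
open import Relation.Nullary.Negation using (¬_; contradiction)

-- The obstacle is that divisibility of `newton` products is not stable under removing a digit. If x
-- = d + t y and j has last digit i and leading part j′, the q factors sharing j′ multiply to w ^ q
-- - w with w = t (y - a_j′), which is no Newton factor of y. Carlitz's functions absorb this: E s
-- (t ^ s c) = c for constants c, so E s (t ^ s (x - a_j)) is E s (t ^ (s + 1) (y - a_j′)) plus a
-- constant depending on i, and a full block becomes a fixed multiplier, free of y, times the factor
-- at level s + 1. Hence the claim is proved for all s at once, although only s = 0 is wanted. The
-- incomplete last block is harmless: on the dividing side, x = a_k, it consists of differences of
-- distinct constants, which are units.
--
-- No division is carried out to define E: additivity, the vanishing of E (s + 1) on constants and
-- Carlitz's identity E (s + 1) (t z) = t E (s + 1) z + (E s z) ^ q give a recursion on coefficient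
-- lists, which is taken as the definition.

-- A ring solver with integer coefficients over any commutative ring.

module IntegerCoefficients {c ℓ} (R : CommutativeRing c ℓ) where

  open CommutativeRing R
  open Algebra.Properties.Ring ring
  open Algebra.Properties.AbelianGroup +-abelianGroup using (⁻¹-∙-comm)
  open Algebra.Properties.Semiring.Mult.TCOptimised semiring using (1+×; ×-homo-+; ×1-homo-*) renaming (_×_ to _×′_)
  open SetoidReasoning setoid

  fromℤ : ℤ → Carrier
  fromℤ (ℤ.+ n)   = n ×′ 1#
  fromℤ (-[1+ n ]) = - (suc n ×′ 1#)

  fromℤ-⊖ : ∀ m n → fromℤ (m ℤ.⊖ n) ≈ (m ×′ 1#) - (n ×′ 1#)
  fromℤ-⊖ m zero = sym (trans (+-congˡ -0#≈0#) (+-identityʳ _))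
  fromℤ-⊖ zero (suc n) = sym (+-identityˡ _)
  fromℤ-⊖ (suc m) (suc n) = begin
    fromℤ (suc m ℤ.⊖ suc n)                 ≡⟨ ≡.cong fromℤ (ℤ.[1+m]⊖[1+n]≡m⊖n m n) ⟩
    fromℤ (m ℤ.⊖ n)                         ≈⟨ fromℤ-⊖ m n ⟩
    (m ×′ 1#) - (n ×′ 1#)                     ≈⟨ +-congʳ (xy⁻¹∙y (m ×′ 1#)) ⟨
    (m ×′ 1#) + 1# - 1# - (n ×′ 1#)           ≈⟨ +-assoc _ _ _ ⟩
    (m ×′ 1#) + 1# + (- 1# - (n ×′ 1#))       ≈⟨ +-cong (+-comm _ _) (⁻¹-∙-comm 1# (n ×′ 1#)) ⟩
    (1# + (m ×′ 1#)) - (1# + (n ×′ 1#))       ≈⟨ +-cong (1+× m 1#) (-‿cong (1+× n 1#)) ⟨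
    (suc m ×′ 1#) - (suc n ×′ 1#)             ∎
    where
    xy⁻¹∙y : ∀ x → x + 1# - 1# ≈ x
    xy⁻¹∙y x = trans (+-assoc _ _ _) (trans (+-congˡ (-‿inverseʳ 1#)) (+-identityʳ x))

  fromℤ-neg : ∀ i → fromℤ (ℤ.- i) ≈ - fromℤ i
  fromℤ-neg -[1+ n ] = sym (-‿involutive _)
  fromℤ-neg +0       = sym -0#≈0#
  fromℤ-neg +[1+ n ] = refl

  fromℤ-+ : ∀ i j → fromℤ (i ℤ.+ j) ≈ fromℤ i + fromℤ j
  fromℤ-+ (ℤ.+ m)  (ℤ.+ n)  = ×-homo-+ 1# m n
  fromℤ-+ (ℤ.+ m)  -[1+ n ] = fromℤ-⊖ m (suc n)
  fromℤ-+ -[1+ m ] (ℤ.+ n)  = trans (fromℤ-⊖ n (suc m)) (+-comm _ _)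
  fromℤ-+ -[1+ m ] -[1+ n ] = begin
    fromℤ (-[1+ m ] ℤ.+ -[1+ n ])        ≡⟨ ≡.cong fromℤ (ℤ.neg-distrib-+ +[1+ m ] +[1+ n ]) ⟨
    - ((suc m ℕ.+ suc n) ×′ 1#)           ≈⟨ -‿cong (×-homo-+ 1# (suc m) (suc n)) ⟩
    - ((suc m ×′ 1#) + (suc n ×′ 1#))      ≈⟨ ⁻¹-∙-comm _ _ ⟨
    - (suc m ×′ 1#) - (suc n ×′ 1#)        ∎

  fromℤ-ℕ* : ∀ m j → fromℤ (ℤ.+ m ℤ.* j) ≈ (m ×′ 1#) * fromℤ j
  fromℤ-ℕ* m (ℤ.+ n)  = trans (reflexive (≡.cong fromℤ (≡.sym (ℤ.pos-* m n)))) (×1-homo-* m n)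
  fromℤ-ℕ* m -[1+ n ] = begin
    fromℤ (ℤ.+ m ℤ.* ℤ.- +[1+ n ])     ≡⟨ ≡.cong fromℤ (ℤ.neg-distribʳ-* (ℤ.+ m) +[1+ n ]) ⟨
    fromℤ (ℤ.- (ℤ.+ m ℤ.* +[1+ n ]))   ≈⟨ fromℤ-neg (ℤ.+ m ℤ.* +[1+ n ]) ⟩
    - fromℤ (ℤ.+ m ℤ.* +[1+ n ])       ≈⟨ -‿cong (fromℤ-ℕ* m +[1+ n ]) ⟩
    - ((m ×′ 1#) * (suc n ×′ 1#))        ≈⟨ -‿distribʳ-* _ _ ⟩
    (m ×′ 1#) * - (suc n ×′ 1#)          ∎

  fromℤ-* : ∀ i j → fromℤ (i ℤ.* j) ≈ fromℤ i * fromℤ j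
  fromℤ-* (ℤ.+ m)  j = fromℤ-ℕ* m j
  fromℤ-* -[1+ m ] j = begin
    fromℤ (ℤ.- +[1+ m ] ℤ.* j)    ≡⟨ ≡.cong fromℤ (ℤ.neg-distribˡ-* +[1+ m ] j) ⟨
    fromℤ (ℤ.- (+[1+ m ] ℤ.* j))  ≈⟨ fromℤ-neg (+[1+ m ] ℤ.* j) ⟩
    - fromℤ (+[1+ m ] ℤ.* j)      ≈⟨ -‿cong (fromℤ-ℕ* (suc m) j) ⟩
    - ((suc m ×′ 1#) * fromℤ j)    ≈⟨ -‿distribˡ-* _ _ ⟩
    - (suc m ×′ 1#) * fromℤ j      ∎

  fromℤ-homomorphism : +-*-rawRing -Raw-AlmostCommutative⟶ fromCommutativeRing R
  fromℤ-homomorphism = record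
    { ⟦_⟧ = fromℤ ; +-homo = fromℤ-+ ; *-homo = fromℤ-* ; -‿homo = fromℤ-neg
    ; 0-homo = refl ; 1-homo = refl }

  -- Deciding equality in ℤ lets the solver cancel terms over rings whose own equality is not
  -- assumed decidable, such as A/g.
  _≟fromℤ_ : ∀ i j → Maybe.Maybe (fromℤ i ≈ fromℤ j)
  i ≟fromℤ j = Maybe.map (λ eq → reflexive (≡.cong fromℤ eq)) (dec⇒maybe (i ℤ.≟ j))

  open Algebra.Solver.Ring +-*-rawRing (fromCommutativeRing R) fromℤ-homomorphism _≟fromℤ_ public
    using (solve; con; _:=_; _:+_; _:*_; _:-_; :-_)

-- Linear combinations of functions, and triangular systems.

module Spans {c ℓ x} (R : CommutativeRing c ℓ) (X : Set x) where

  open CommutativeRing R hiding (zero)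
  open IntegerCoefficients R
  open SetoidReasoning setoid

  private variable
    K K′ L : Set
    k : K
    ks : List K
    ks′ : List K′
    β : K → X → Carrier
    β′ : K′ → X → Carrier
    γ : L → X → Carrier
    θ θ′ : X → Carrier

  -- Subtracting one term at a time keeps the remainder as the index, so no sum is formed and
  -- closure properties are recursions on the list. It is used over A for identities in one
  -- variable, and over A/g with residue points as `X` for the count.
  data Span {K : Set} (β : K → X → Carrier) : List K → (X → Carrier) → Set (c ⊔ ℓ ⊔ x) where
    []  : (∀ p → θ p ≈ 0#) → Span β [] θ
    _∷_ : ∀ a → Span β ks (λ p → θ p - a * β k p) → Span β (k ∷ ks) θ

  span-resp : (∀ p → θ p ≈ θ′ p) → Span β ks θ → Span β ks θ′
  span-resp eq ([] θ≈0) = [] λ p → trans (sym (eq p)) (θ≈0 p)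
  span-resp eq (a ∷ s)  = a ∷ span-resp (λ p → +-congʳ (eq p)) s

  span-0 : (∀ p → θ p ≈ 0#) → Span β ks θ
  span-0 {ks = []}    θ≈0 = [] θ≈0
  span-0 {θ = θ} {β = β} {ks = k ∷ ks} θ≈0 = 0# ∷ span-0 λ p →
    trans (solve 2 (λ u v → u :- con 0ℤ :* v := u) refl (θ p) (β k p)) (θ≈0 p)

  span-+ : Span β ks θ → Span β ks θ′ → Span β ks (λ p → θ p + θ′ p)
  span-+ ([] θ≈0) ([] θ′≈0) = [] λ p → trans (+-cong (θ≈0 p) (θ′≈0 p)) (+-identityˡ 0#)
  span-+ {β = β} {ks = k ∷ _} {θ = θ} {θ′ = θ′} (a ∷ s) (b ∷ s′) = (a + b) ∷ span-resp
    (λ p → solve 5 (λ u v a b w → (u :- a :* w) :+ (v :- b :* w) := (u :+ v) :- (a :+ b) :* w)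
             refl (θ p) (θ′ p) a b (β k p))
    (span-+ s s′)

  span-* : ∀ b → Span β ks θ → Span β ks (λ p → b * θ p)
  span-* b ([] θ≈0) = [] λ p → trans (*-congˡ (θ≈0 p)) (zeroʳ b)
  span-* {β = β} {ks = k ∷ _} {θ = θ} b (a ∷ s) = (b * a) ∷ span-resp
    (λ p → solve 4 (λ b u a w → b :* (u :- a :* w) := b :* u :- b :* a :* w) refl b (θ p) a (β k p))
    (span-* b s)

  span-++ : ∀ {ks′} → Span β ks θ → Span β ks′ θ′ → Span β (ks ++ ks′) (λ p → θ p + θ′ p)
  span-++ ([] θ≈0) s′ = span-resp (λ p → sym (trans (+-congʳ (θ≈0 p)) (+-identityˡ _))) s′
  span-++ {β = β} {ks = k ∷ _} {θ = θ} {θ′ = θ′} (a ∷ s) s′ = a ∷ span-resp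
    (λ p → solve 4 (λ u v a w → u :- a :* w :+ v := u :+ v :- a :* w) refl (θ p) (θ′ p) a (β k p))
    (span-++ s s′)

  span-∈ : ∀ a → k ∈ ks → Span β ks (λ p → a * β k p)
  span-∈ a (here ≡.refl) = a ∷ span-0 λ p → -‿inverseʳ _
  span-∈ {k = k} {β = β} a (there {k′} k∈ks) = 0# ∷ span-resp
    (λ p → solve 3 (λ a u v → a :* u := a :* u :- con 0ℤ :* v) refl a (β k p) (β k′ p))
    (span-∈ a k∈ks)

  span-map : ∀ (h : X → Carrier) → All (λ k → Span β′ ks′ (λ p → h p * β k p)) ks → Span β ks θ →
             Span β′ ks′ (λ p → h p * θ p)
  span-map h [] ([] θ≈0) = span-0 λ p → trans (*-congˡ (θ≈0 p)) (zeroʳ (h p))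
  span-map {β = β} {ks = k ∷ _} {θ = θ} h (sₖ ∷ sₖₛ) (a ∷ s) = span-resp
    (λ p → solve 4 (λ a h w u → a :* (h :* w) :+ h :* (u :- a :* w) := h :* u)
             refl a (h p) (β k p) (θ p))
    (span-+ (span-* a sₖ) (span-map h sₖₛ s))

  -- No bound on the indices is kept: it serves the changes of basis between powers and Newton
  -- products, where only finiteness matters.
  span-map-∃ : ∀ (h : X → Carrier) → (∀ k → ∃ λ ks′ → Span β′ ks′ (λ p → h p * β k p)) → Span β ks θ →
               ∃ λ ks′ → Span β′ ks′ (λ p → h p * θ p)
  span-map-∃ h f ([] θ≈0) = [] , [] λ p → trans (*-congˡ (θ≈0 p)) (zeroʳ (h p))
  span-map-∃ {β = β} {ks = k ∷ _} {θ = θ} h f (a ∷ s) =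
    proj₁ (f k) ++ proj₁ rest , span-resp
      (λ p → solve 4 (λ a h w u → a :* (h :* w) :+ h :* (u :- a :* w) := h :* u)
               refl a (h p) (β k p) (θ p))
      (span-++ (span-* a (proj₂ (f k))) (proj₂ rest))
    where rest = span-map-∃ h f s

  -- The index pairs are listed as in `box`, so spans in separate variables multiply into a span
  -- over the box.
  span-⊗ : ∀ (_∙_ : K → K′ → L) → (∀ k k′ p → γ (k ∙ k′) p ≈ β k p * β′ k′ p) →
           Span β ks θ → Span β′ ks′ θ′ →
           Span γ (cartesianProductWith _∙_ ks ks′) (λ p → θ p * θ′ p)
  span-⊗ {θ′ = θ′} _∙_ γ≈ ([] θ≈0) s′ = [] λ p → trans (*-congʳ (θ≈0 p)) (zeroˡ (θ′ p))
  span-⊗ {γ = γ} {β = β} {β′ = β′} {ks = k ∷ _} {θ = θ} {θ′ = θ′} _∙_ γ≈ (a ∷ s) s′ = span-resp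
    (λ p → solve 4 (λ a w u v → a :* w :* v :+ (u :- a :* w) :* v := u :* v)
             refl a (β k p) (θ p) (θ′ p))
    (span-++ (row s′) (span-⊗ _∙_ γ≈ s s′))
    where
    row : ∀ {ks′ θ′} → Span β′ ks′ θ′ → Span γ (map (k ∙_) ks′) (λ p → a * β k p * θ′ p)
    row ([] θ′≈0) = [] λ p → trans (*-congˡ (θ′≈0 p)) (zeroʳ _)
    row {k′ ∷ _} {θ′} (b ∷ s) = (a * b) ∷ span-resp
      (λ p → trans
        (solve 5 (λ a w u b v → a :* w :* (u :- b :* v) := a :* w :* u :- a :* b :* (w :* v))
           refl a (β k p) (θ′ p) b (β′ k′ p))
        (+-congˡ (-‿cong (*-congˡ (sym (γ≈ k k′ p))))))
      (row s)

  -- `S` is the condition on the diagonal entry: a root with regularity in `root-uniqueness`,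
  -- separation of representatives in the count.
  data Triangular {K : Set} {s} (β : K → X → Carrier) (S : K → X → Set s) : List K → Set (ℓ ⊔ s ⊔ x) where
    []  : Triangular β S []
    _∷_ : (∃ λ p → S k p × All (λ k′ → β k′ p ≈ 0#) ks) → Triangular β S ks → Triangular β S (k ∷ ks)

  span-kills : Span β ks θ → ∀ p → All (λ k → β k p ≈ 0#) ks → θ p ≈ 0#
  span-kills ([] θ≈0) p [] = θ≈0 p
  span-kills {β = β} {ks = k ∷ _} {θ = θ} (a ∷ s) p (eq ∷ eqs) = begin
    θ p                          ≈⟨ solve 3 (λ u a w → u := u :- a :* w :+ a :* w) refl (θ p) a (β k p) ⟩
    θ p - a * β k p + a * β k p  ≈⟨ +-cong (span-kills s p eqs) (trans (*-congˡ eq) (zeroʳ a)) ⟩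
    0# + 0#                      ≈⟨ +-identityˡ 0# ⟩
    0#                           ∎

  -- At the point of the head all later basis functions vanish, so `θ p ≈ 0#` leaves only
  -- `a * β k p`. Cancelling kills the leading coefficient, and then the tail alone spans `θ`.
  root-uniqueness : Triangular β (λ k p → θ p ≈ 0# × (∀ a → a * β k p ≈ 0# → a ≈ 0#)) ks →
                    Span β ks θ → ∀ p → θ p ≈ 0#
  root-uniqueness [] ([] θ≈0) = θ≈0
  root-uniqueness {β = β} {θ = θ} {ks = k ∷ _} ((p , (θp≈0 , cancel) , β≈0) ∷ t) (a ∷ s) =
    root-uniqueness t (span-resp (λ p → begin
      θ p - a * β k p   ≈⟨ +-congˡ (-‿cong (*-congʳ a≈0)) ⟩
      θ p - 0# * β k p  ≈⟨ solve 2 (λ u w → u :- con 0ℤ :* w := u) refl (θ p) (β k p) ⟩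
      θ p               ∎) s)
    where
    a≈0 : a ≈ 0#
    a≈0 = cancel a (begin
      a * β k p              ≈⟨ solve 2 (λ u w → w := u :- (u :- w)) refl (θ p) (a * β k p) ⟩
      θ p - (θ p - a * β k p) ≈⟨ +-cong θp≈0 (-‿cong (span-kills s p β≈0)) ⟩
      0# - 0#                ≈⟨ -‿inverseʳ 0# ⟩
      0#                     ∎)

  module Combinations {K : Set} (β : K → X → Carrier) (w : K → ℕ) (ρ : ∀ k → Fin (w k) → Carrier) where

    size : List K → ℕ
    size ks = product (map w ks)

    -- `n` is read in mixed radix: its leading digit selects the first coefficient among the
    -- representatives `ρ k`, the rest encodes the others. This is how the count becomes a product.
    combination : ∀ ks → Fin (size ks) → X → Carrier
    combination []       _ p = 0#
    combination (k ∷ ks) n p =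
      ρ k (proj₁ (remQuot (size ks) n)) * β k p + combination ks (proj₂ (remQuot {w k} (size ks) n)) p

    span⇒combination : (∀ k a → ∃ λ i → ∀ p → ρ k i * β k p ≈ a * β k p) →
                       Span β ks θ → ∃ λ n → ∀ p → combination ks n p ≈ θ p
    span⇒combination reduce ([] θ≈0) = Fin.zero , λ p → sym (θ≈0 p)
    span⇒combination {ks = k ∷ ks} {θ = θ} reduce (a ∷ s) with reduce k a | span⇒combination reduce s
    ... | i , i≈a | n , n≈θ = combine i n , λ p → begin
      ρ k (proj₁ (remQuot (size ks) (combine i n))) * β k p +
        combination ks (proj₂ (remQuot {w k} (size ks) (combine i n))) p
          ≡⟨ ≡.cong (λ (i , n) → ρ k i * β k p + combination ks n p) (remQuot-combine i n) ⟩
      ρ k i * β k p + combination ks n p  ≈⟨ +-cong (i≈a p) (n≈θ p) ⟩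
      a * β k p + (θ p - a * β k p)       ≈⟨ solve 2 (λ u v → v :+ (u :- v) := u) refl (θ p) (a * β k p) ⟩
      θ p                                 ∎

    combination-vanishes : ∀ ks n p → All (λ k → β k p ≈ 0#) ks → combination ks n p ≈ 0#
    combination-vanishes []       n p []         = refl
    combination-vanishes (k ∷ ks) n p (eq ∷ eqs) = trans
      (+-cong (trans (*-congˡ eq) (zeroʳ _)) (combination-vanishes ks _ p eqs)) (+-identityˡ 0#)

    Separates : K → X → Set ℓ
    Separates k p = ∀ i j → ρ k i * β k p ≈ ρ k j * β k p → i ≡ j

    -- At the point of the head only the leading term survives, which fixes the leading digit; that
    -- term can then be subtracted at every point.
    combination-injective : Triangular β Separates ks → ∀ m n →
      (∀ p → combination ks m p ≈ combination ks n p) → m ≡ n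
    combination-injective [] Fin.zero Fin.zero _ = ≡.refl
    combination-injective {ks = k ∷ ks} ((p , separates , β≈0) ∷ t) m n eq =
      ≡.trans (≡.sym (combine-remQuot {w k} (size ks) m))
        (≡.trans (≡.cong₂ combine i≡j (combination-injective t m′ n′ rest))
          (combine-remQuot {w k} (size ks) n))
      where
      i  = proj₁ (remQuot {w k} (size ks) m)
      j  = proj₁ (remQuot {w k} (size ks) n)
      m′ = proj₂ (remQuot {w k} (size ks) m)
      n′ = proj₂ (remQuot {w k} (size ks) n)

      leading : ∀ i n → ρ k i * β k p + combination ks n p ≈ ρ k i * β k p
      leading i n = trans (+-congˡ (combination-vanishes ks n p β≈0)) (+-identityʳ _)

      i≡j : i ≡ j
      i≡j = separates i j (trans (sym (leading i m′)) (trans (eq p) (leading j n′)))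

      rest : ∀ p → combination ks m′ p ≈ combination ks n′ p
      rest p = begin
        combination ks m′ p
          ≈⟨ solve 2 (λ u v → v := u :+ v :- u) refl (ρ k i * β k p) (combination ks m′ p) ⟩
        ρ k i * β k p + combination ks m′ p - ρ k i * β k p
          ≈⟨ +-cong (eq p) (-‿cong (*-congʳ (reflexive (≡.cong (ρ k) i≡j)))) ⟩
        ρ k j * β k p + combination ks n′ p - ρ k j * β k p
          ≈⟨ solve 2 (λ u v → u :+ v :- u := v) refl (ρ k j * β k p) (combination ks n′ p) ⟩
        combination ks n′ p ∎

module Triangularity {c ℓ x} (R : CommutativeRing c ℓ) (X : Set x) where
  open CommutativeRing R
  open Spans R X

  triangular⁺ : ∀ {K : Set} {r s} {_⊏_ : K → K → Set r} {β : K → X → Carrier} {S : K → X → Set s} {ks} →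
    AllPairs _⊏_ ks → All (λ k → ∃ λ p → S k p × (∀ k′ → k ⊏ k′ → β k′ p ≈ 0#)) ks → Triangular β S ks
  triangular⁺ []       []                       = []
  triangular⁺ (⊏ ∷ ap) ((p , sep , kills) ∷ ps) =
    (p , sep , All.map (kills _) ⊏) ∷ triangular⁺ ap ps

-- Products of initial segments of sequences.

module Products {c ℓ} (R : CommutativeRing c ℓ) where

  open CommutativeRing R hiding (zero)
  open IntegerCoefficients R
  open SetoidReasoning setoid
  open Divisibility R using (_∣_; _,_)
  open Algebra.Properties.CommutativeSemigroup.Divisibility *-commutativeSemigroup using (∙-cong-∣)
  open RawSemiringDefs (Semiring.rawSemiring semiring) using (_^_) renaming (product to ∏)
  private module ∏ = Algebra.Properties.CommutativeMonoid.Sum *-commutativeMonoid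

  -- Unlike `∏`, this splits off the last factor, so `newton (suc k)` is by definition `newton k`
  -- times its new factor.
  prod : (ℕ → Carrier) → ℕ → Carrier
  prod u zero    = 1#
  prod u (suc n) = prod u n * u n

  prod-cong-< : ∀ {u v} n → (∀ i → i ℕ.< n → u i ≈ v i) → prod u n ≈ prod v n
  prod-cong-< zero    eq = refl
  prod-cong-< (suc n) eq =
    *-cong (prod-cong-< n λ i i<n → eq i (ℕ.m<n⇒m<1+n i<n)) (eq n ℕ.≤-refl)

  prod-cong : ∀ {u v} n → (∀ i → u i ≈ v i) → prod u n ≈ prod v n
  prod-cong n eq = prod-cong-< n λ i _ → eq i

  ∏-prod : ∀ (u : ℕ → Carrier) n → ∏ {n} (u ∘ toℕ) ≈ prod u n
  ∏-prod u zero    = refl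
  ∏-prod u (suc n) = begin
    ∏ {suc n} (u ∘ toℕ)                         ≈⟨ ∏.sum-init-last (u ∘ toℕ) ⟩
    ∏ {n} (u ∘ toℕ ∘ inject₁) * u (toℕ (fromℕ n))
      ≡⟨ ≡.cong₂ _*_ (∏.sum-cong-≗ {n} λ i → ≡.cong u (toℕ-inject₁ i)) (≡.cong u (toℕ-fromℕ n)) ⟩
    ∏ {n} (u ∘ toℕ) * u n                       ≈⟨ *-congʳ (∏-prod u n) ⟩
    prod u n * u n                              ∎

  prod-* : ∀ (u v : ℕ → Carrier) n → prod (λ i → u i * v i) n ≈ prod u n * prod v n
  prod-* u v zero    = sym (*-identityˡ 1#)
  prod-* u v (suc n) = begin
    prod (λ i → u i * v i) n * (u n * v n)  ≈⟨ *-congʳ (prod-* u v n) ⟩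
    prod u n * prod v n * (u n * v n)
      ≈⟨ solve 4 (λ a b c d → a :* b :* (c :* d) := a :* c :* (b :* d)) refl (prod u n) (prod v n) (u n) (v n) ⟩
    prod u n * u n * (prod v n * v n)       ∎

  prod-+ : ∀ (u : ℕ → Carrier) m n → prod u (m ℕ.+ n) ≈ prod u m * prod (λ i → u (m ℕ.+ i)) n
  prod-+ u m zero    = trans (reflexive (≡.cong (prod u) (ℕ.+-identityʳ m))) (sym (*-identityʳ _))
  prod-+ u m (suc n) = begin
    prod u (m ℕ.+ suc n)                                      ≡⟨ ≡.cong (prod u) (ℕ.+-suc m n) ⟩
    prod u (m ℕ.+ n) * u (m ℕ.+ n)                            ≈⟨ *-congʳ (prod-+ u m n) ⟩
    prod u m * prod (λ i → u (m ℕ.+ i)) n * u (m ℕ.+ n)       ≈⟨ *-assoc _ _ _ ⟩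
    prod u m * (prod (λ i → u (m ℕ.+ i)) n * u (m ℕ.+ n))     ∎

  prod-blocks : ∀ (u : ℕ → Carrier) q k →
    prod u (k ℕ.* q) ≈ prod (λ j → prod (λ i → u (j ℕ.* q ℕ.+ i)) q) k
  prod-blocks u q zero    = refl
  prod-blocks u q (suc k) = begin
    prod u (q ℕ.+ k ℕ.* q)                                     ≡⟨ ≡.cong (prod u) (ℕ.+-comm q (k ℕ.* q)) ⟩
    prod u (k ℕ.* q ℕ.+ q)                                     ≈⟨ prod-+ u (k ℕ.* q) q ⟩
    prod u (k ℕ.* q) * prod (λ i → u (k ℕ.* q ℕ.+ i)) q        ≈⟨ *-congʳ (prod-blocks u q k) ⟩
    prod (λ j → prod (λ i → u (j ℕ.* q ℕ.+ i)) q) (suc k)      ∎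

  prod-zero : ∀ {u : ℕ → Carrier} {i n} → i ℕ.< n → u i ≈ 0# → prod u n ≈ 0#
  prod-zero {n = suc n} i<1+n ui≈0 with ℕ.m≤n⇒m<n∨m≡n (ℕ.≤-pred i<1+n)
  ... | inj₁ i<n    = trans (*-congʳ (prod-zero i<n ui≈0)) (zeroˡ _)
  ... | inj₂ ≡.refl = trans (*-congˡ ui≈0) (zeroʳ _)

  prod-∣ : ∀ (u : ℕ → Carrier) {m n} → m ℕ.≤ n → prod u m ∣ prod u n
  prod-∣ u {m} {n} m≤n = prod (λ i → u (m ℕ.+ i)) (n ℕ.∸ m) , (begin
    prod (λ i → u (m ℕ.+ i)) (n ℕ.∸ m) * prod u m  ≈⟨ *-comm _ _ ⟩
    prod u m * prod (λ i → u (m ℕ.+ i)) (n ℕ.∸ m)  ≈⟨ prod-+ u m (n ℕ.∸ m) ⟨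
    prod u (m ℕ.+ (n ℕ.∸ m))                       ≡⟨ ≡.cong (prod u) (ℕ.m+[n∸m]≡n m≤n) ⟩
    prod u n                                       ∎)

  prod-regular : ∀ {u : ℕ → Carrier} n → (∀ i → i ℕ.< n → ∀ y → y * u i ≈ 0# → y ≈ 0#) →
                 ∀ y → y * prod u n ≈ 0# → y ≈ 0#
  prod-regular zero    reg y eq = trans (sym (*-identityʳ y)) eq
  prod-regular (suc n) reg y eq = prod-regular n (λ i i<n → reg i (ℕ.m<n⇒m<1+n i<n)) y
    (reg n ℕ.≤-refl _ (trans (*-assoc _ _ _) eq))

  prod-const : ∀ x n → prod (λ _ → x) n ≈ x ^ n
  prod-const x zero    = refl
  prod-const x (suc n) = trans (*-congʳ (prod-const x n)) (*-comm _ _)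

  ∏-cong-∣ : ∀ {n} (u v : Fin n → Carrier) → (∀ i → u i ∣ v i) → ∏ u ∣ ∏ v
  ∏-cong-∣ {zero}  u v u∣v = 1# , *-identityˡ 1#
  ∏-cong-∣ {suc n} u v u∣v = ∙-cong-∣ (u∣v Fin.zero) (∏-cong-∣ (u ∘ Fin.suc) (v ∘ Fin.suc) (u∣v ∘ Fin.suc))

  ∏-0 : ∀ {n} (u : Fin n → Carrier) i → u i ≈ 0# → ∏ u ≈ 0#
  ∏-0 {suc n} u Fin.zero    eq = trans (*-congʳ eq) (zeroˡ _)
  ∏-0 {suc n} u (Fin.suc i) eq = trans (*-congˡ (∏-0 (u ∘ Fin.suc) i eq)) (zeroʳ _)

-- Newton products in one variable.

module Newton {c ℓ} (R : CommutativeRing c ℓ) (a : ℕ → CommutativeRing.Carrier R) where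

  open CommutativeRing R hiding (zero)
  open IntegerCoefficients R
  open Products R
  open RawSemiringDefs (Semiring.rawSemiring semiring) using (_^_)
  open Spans R Carrier
  open Triangularity R Carrier

  newton : ℕ → Carrier → Carrier
  newton k z = prod (λ j → z - a j) k

  power : ℕ → Carrier → Carrier
  power n z = z ^ n

  -- z + b = (z - a j) + (b + a j), and the first summand raises the index.
  linear-newton : ∀ b j {ks} → suc j ∈ ks → j ∈ ks → Span newton ks (λ z → (z + b) * newton j z)
  linear-newton b j 1+j∈ j∈ = span-resp
    (λ z → solve 4 (λ z b u n → con 1ℤ :* (n :* (z :- u)) :+ (b :+ u) :* n := (z :+ b) :* n)
             refl z b (a j) (newton j z))
    (span-+ (span-∈ 1# 1+j∈) (span-∈ (b + a j) j∈))

  -- The leading terms of two monic products cancel. The span of `newton` over `upTo n` is how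
  -- "degree below n" is expressed for functions throughout.
  monic-newton : ∀ (b : ℕ → Carrier) n → Span newton (upTo n) (λ z → prod (λ j → z + b j) n - newton n z)
  monic-newton b zero    = span-0 λ _ → -‿inverseʳ 1#
  monic-newton b (suc n) = span-resp
    (λ z → solve 5 (λ z b u p n → (z :+ b) :* (p :- n) :+ (b :+ u) :* n := p :* (z :+ b) :- n :* (z :- u))
             refl z (b n) (a n) (prod (λ j → z + b j) n) (newton n z))
    (span-+
      (span-map (λ z → z + b n)
        (All.applyUpTo⁺₁ id n λ {j} j<n →
          linear-newton (b n) j (∈-upTo⁺ (ℕ.s≤s j<n)) (∈-upTo⁺ (ℕ.m<n⇒m<1+n j<n)))
        (monic-newton b n))
      (span-∈ (b n + a n) (∈-upTo⁺ ℕ.≤-refl)))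

  newton-root : ∀ {k j} → j ℕ.< k → newton k (a j) ≈ 0#
  newton-root j<k = prod-zero j<k (-‿inverseʳ _)

  -- Takes the place of counting the roots of a polynomial of degree below n: at the points `a 0`,
  -- ..., `a (n - 1)` the Newton products form a triangular matrix with regular diagonal.
  zero-by-roots : (∀ k y → y * newton k (a k) ≈ 0# → y ≈ 0#) →
    ∀ n {θ} → Span newton (upTo n) θ → (∀ j → j ℕ.< n → θ (a j) ≈ 0#) → ∀ z → θ z ≈ 0#
  zero-by-roots regular n s roots = root-uniqueness
    (triangular⁺ {_⊏_ = ℕ._<_} (AllPairs.applyUpTo⁺₁ id n λ i<j _ → i<j)
      (All.applyUpTo⁺₁ id n λ {j} j<n → a j , (roots j j<n , regular j) , λ _ → newton-root))
    s

  -- This direction makes every polynomial function a Newton combination; `newton-in-powers` makes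
  -- every Newton combination a polynomial function.
  power-in-newtons : ∀ n → ∃ λ ks → Span newton ks (power n)
  power-in-newtons zero    = (0 ∷ []) , span-resp (λ _ → *-identityˡ 1#) (span-∈ {k = 0} 1# (here ≡.refl))
  power-in-newtons (suc n) = span-map-∃ id
    (λ j → _ , span-resp (λ z → *-congʳ (+-identityʳ z))
      (linear-newton 0# j {suc j ∷ j ∷ []} (here ≡.refl) (there (here ≡.refl))))
    (proj₂ (power-in-newtons n))

  newton-in-powers : ∀ k → ∃ λ ks → Span power ks (newton k)
  newton-in-powers zero    = (0 ∷ []) , span-resp (λ _ → *-identityˡ 1#) (span-∈ {k = 0} 1# (here ≡.refl))
  newton-in-powers (suc k) = _ , span-resp (λ z → *-comm _ _) (proj₂ (span-map-∃ (λ z → z - a k)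
    (λ n → (suc n ∷ n ∷ []) , span-resp
      (λ z → solve 3 (λ z u p → con 1ℤ :* (z :* p) :+ (:- u) :* p := (z :- u) :* p) refl z (a k) (z ^ n))
      (span-+ (span-∈ {k = suc n} 1# (here ≡.refl)) (span-∈ {k = n} (- a k) (there (here ≡.refl)))))
    (proj₂ (newton-in-powers k))))

-- Fermat's little theorem by permuting a product.

module Fermat {c ℓ} (R : CommutativeRing c ℓ) where

  open CommutativeRing R hiding (zero)
  open IntegerCoefficients R
  open SetoidReasoning setoid
  open RawSemiringDefs (Semiring.rawSemiring semiring) using (_^_) renaming (product to ∏)
  private module ∏ = Algebra.Properties.CommutativeMonoid.Sum *-commutativeMonoid

  ∏-regular : ∀ {n} (u : Fin n → Carrier) → (∀ i y → y * u i ≈ 0# → y ≈ 0#) →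
              ∀ y → y * ∏ u ≈ 0# → y ≈ 0#
  ∏-regular {zero}  u reg y eq = trans (sym (*-identityʳ y)) eq
  ∏-regular {suc n} u reg y eq =
    reg Fin.zero y (∏-regular (u ∘ Fin.suc) (reg ∘ Fin.suc) _ (trans (*-assoc _ _ _) eq))

  -- Multiplication by `x` permutes the entries of nonzero index, so it fixes their product and also
  -- scales it by `x` to the power m - 1; the product cancels. Index 0, fixed by `π` and not assumed
  -- regular, is kept out of it.
  fermat : ∀ {m} → 0 ℕ.< m → (e : Fin m → Carrier) (π : Permutation m m) (x : Carrier) →
           (∀ i → toℕ i ≡ 0 → toℕ (π ⟨$⟩ʳ i) ≡ 0) →
           (∀ i → 0 ℕ.< toℕ i → ∀ y → y * e i ≈ 0# → y ≈ 0#) →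
           (∀ i → x * e i ≈ e (π ⟨$⟩ʳ i)) → x ^ m ≈ x
  fermat {suc n} _ e π x π0 reg scale = begin
    x * x ^ n                ≈⟨ solve 2 (λ x y → x :* y := x :+ x :* (y :- con 1ℤ)) refl x (x ^ n) ⟩
    x + x * (x ^ n - 1#)     ≈⟨ +-congˡ (*-congˡ x^n-1≈0) ⟩
    x + x * 0#               ≈⟨ solve 1 (λ x → x :+ x :* con 0ℤ := x) refl x ⟩
    x                        ∎
    where
    σ : Permutation n n
    σ = Permutation.remove Fin.zero π

    π-suc : ∀ i → π ⟨$⟩ʳ Fin.suc i ≡ Fin.suc (σ ⟨$⟩ʳ i)
    π-suc i = ≡.trans (Permutation.punchIn-permute π Fin.zero i)
      (≡.cong (λ k → Fin.punchIn k (σ ⟨$⟩ʳ i)) (Fin.toℕ-injective (π0 Fin.zero ≡.refl)))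

    units : Carrier
    units = ∏ (e ∘ Fin.suc)

    x^n*units : x ^ n * units ≈ units
    x^n*units = begin
      x ^ n * units                        ≈⟨ *-congʳ (∏.sum-replicate n) ⟨
      ∏ {n} (λ _ → x) * units              ≈⟨ ∏.∑-distrib-+ (λ _ → x) (e ∘ Fin.suc) ⟨
      ∏ {n} (λ i → x * e (Fin.suc i))      ≈⟨ ∏.sum-cong-≋ {n} (λ i → trans (scale (Fin.suc i))
                                                (reflexive (≡.cong e (π-suc i)))) ⟩
      ∏ {n} (λ i → e (Fin.suc (σ ⟨$⟩ʳ i))) ≈⟨ ∏.sum-permute (e ∘ Fin.suc) σ ⟨
      units                                ∎

    x^n-1≈0 : x ^ n - 1# ≈ 0#
    x^n-1≈0 = ∏-regular (e ∘ Fin.suc) (λ i → reg (Fin.suc i) (s≤s z≤n)) _ (begin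
      (x ^ n - 1#) * units     ≈⟨ solve 2 (λ x u → (x :- con 1ℤ) :* u := x :* u :- u) refl (x ^ n) units ⟩
      x ^ n * units - units    ≈⟨ +-congʳ x^n*units ⟩
      units - units            ≈⟨ -‿inverseʳ units ⟩
      0#                       ∎)

-- The enumeration of A by base-q digits, and q-th powers.

module FiniteFieldLemmas {c ℓ₁ ℓ₂} (𝔽 : FiniteField c ℓ₁ ℓ₂) where

  open FiniteFieldPolynomials 𝔽
  module A where
    open CommutativeRing F[t] public
    open Algebra.Properties.Ring ring public

  open IntegerCoefficients F[t]
  open Products F[t]
  open Newton F[t] a
  open Algebra.Properties.CommutativeSemiring.Exp A.commutativeSemiring using (^-congˡ; ^-distrib-*)
  open SetoidReasoning A.setoid

  0<q : 0 ℕ.< q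
  0<q = ℕ.<⇒≤ 2≤q

  const : F.Carrier → A
  const x = x ∷ []

  index-unique : ∀ {x i} → x F.≈ F.element i → index x ≡ i
  index-unique {x} eq = Bijection.injective F.enumeration (F.trans (element-index x) eq)

  index-0 : ∀ {x} → x F.≈ F.0# → toℕ (index x) ≡ 0
  index-0 x≈0 = ≡.trans
    (≡.cong toℕ (index-unique (F.trans x≈0 (F.sym (F.element-0 (fromℕ< 0<q) (toℕ-fromℕ< 0<q))))))
    (toℕ-fromℕ< 0<q)

  element-≉0 : ∀ i → 0 ℕ.< toℕ i → ¬ F.element i F.≈ F.0#
  element-≉0 i 0<i eq = ℕ.<⇒≢ 0<i (≡.sym
    (≡.trans (≡.cong toℕ (≡.sym (index-unique F.refl))) (index-0 eq)))

  a-digits : ∀ (i : Fin q) j → a (toℕ i ℕ.+ j ℕ.* q) ≈ F.element i ∷ a j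
  a-digits i j = elements-unique (digits _) (i ∷ digits j)
    (≡.trans (fromDigits-digits _) (≡.cong (λ n → toℕ i ℕ.+ n ℕ.* q) (≡.sym (fromDigits-digits j))))

  a-const : ∀ i → a (toℕ i) ≈ const (F.element i)
  a-const i = begin
    a (toℕ i)              ≡⟨ ≡.cong a (ℕ.+-identityʳ (toℕ i)) ⟨
    a (toℕ i ℕ.+ 0 ℕ.* q)  ≈⟨ a-digits i 0 ⟩
    F.element i ∷ a 0      ≈⟨ ∷-cong F.refl a-0 ⟩
    const (F.element i)    ∎

  elements-vanish : ∀ n ds → fromDigits ds ℕ.< q ℕ.^ n → VanishesFrom n (List.map F.element ds)
  elements-vanish zero    ds       <1  k       _     = coeff≈ (elements-0 ds (ℕ.n<1⇒n≡0 <1)) k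
  elements-vanish (suc n) []       _   k       _     = F.refl
  elements-vanish (suc n) (d ∷ ds) <qⁿ (suc k) n<1+k =
    elements-vanish n ds (ℕ.*-cancelʳ-< _ _ _ (ℕ.≤-<-trans (ℕ.m≤n+m _ (toℕ d))
      (≡.subst (toℕ d ℕ.+ fromDigits ds ℕ.* q ℕ.<_) (ℕ.*-comm q (q ℕ.^ n)) <qⁿ))) k (ℕ.≤-pred n<1+k)

  a-vanishes : ∀ {n j} → j ℕ.< q ℕ.^ n → VanishesFrom n (a j)
  a-vanishes {n} {j} j< = elements-vanish n (digits j) (≡.subst (ℕ._< q ℕ.^ n) (≡.sym (fromDigits-digits j)) j<)

  deg-0 : ∀ p → p ≈ 0# → deg p ≡ 0
  deg-0 []      _   = ≡.refl
  deg-0 (x ∷ p) eq with p ≈0?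
  ... | yes _  = ≡.refl
  ... | no p≉0 = contradiction (coeffs≈ (coeff≈ eq ∘ suc)) p≉0

  -- Positivity of n covers the zero polynomial, whose degree is 0 by convention.
  vanishes⇒deg< : ∀ {n} p → 0 ℕ.< n → VanishesFrom n p → deg p ℕ.< n
  vanishes⇒deg< {n} p 0<n vanish with p ≈0?
  ... | yes p≈0 = ≡.subst (ℕ._< n) (≡.sym (deg-0 p p≈0)) 0<n
  ... | no  p≉0 = ℕ.≰⇒> λ n≤deg → coeff-deg p p≉0 (vanish _ n≤deg)

  deg<⇒vanishes : ∀ {n} p → deg p ℕ.< n → VanishesFrom n p
  deg<⇒vanishes p deg<n k n≤k = vanishes-above-deg p k (ℕ.≤-trans deg<n n≤k)

  number-0 : ∀ p → p ≈ 0# → number p ≡ 0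
  number-0 []      _  = ≡.refl
  number-0 (x ∷ p) eq = ≡.cong₂ ℕ._+_ (index-0 (coeff≈ eq 0))
    (≡.cong (ℕ._* q) (number-0 p (coeffs≈ (coeff≈ eq ∘ suc))))

  number-cong : ∀ p p′ → p ≈ p′ → number p ≡ number p′
  number-cong []      p′       eq = ≡.sym (number-0 p′ (A.sym eq))
  number-cong (x ∷ p) []       eq = number-0 (x ∷ p) eq
  number-cong (x ∷ p) (y ∷ p′) eq = ≡.cong₂ (λ i n → toℕ i ℕ.+ n ℕ.* q)
    (index-unique (F.trans (coeff≈ eq 0) (F.sym (element-index y))))
    (number-cong p p′ (coeffs≈ (coeff≈ eq ∘ suc)))

  number-elements : ∀ ds → number (List.map F.element ds) ≡ fromDigits ds
  number-elements []       = ≡.refl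
  number-elements (d ∷ ds) = ≡.cong₂ (λ i n → toℕ i ℕ.+ n ℕ.* q) (index-unique F.refl) (number-elements ds)

  number-a : ∀ j → number (a j) ≡ j
  number-a j = ≡.trans (number-elements (digits j)) (fromDigits-digits j)

  a-injective : ∀ {i j} → a i ≈ a j → i ≡ j
  a-injective {i} {j} eq = ≡.trans (≡.sym (number-a i)) (≡.trans (number-cong (a i) (a j) eq) (number-a j))

  number-< : ∀ n p → VanishesFrom n p → number p ℕ.< q ℕ.^ n
  number-< zero    p       vanish =
    ℕ.≤-reflexive (≡.cong suc (number-0 p (coeffs≈ λ k → vanish k z≤n)))
  number-< (suc n) []      vanish = ℕ.≤-trans (s≤s z≤n) (ℕ.^-monoʳ-≤ q {{ℕ.>-nonZero 0<q}} {0} {suc n} z≤n)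
  number-< (suc n) (x ∷ p) vanish =
    ℕ.≤-trans (ℕ.+-monoˡ-≤ (number p ℕ.* q) (Fin.toℕ<n (index x)))
      (ℕ.≤-trans (ℕ.*-monoˡ-≤ q (number-< n p λ k n≤k → vanish (suc k) (s≤s n≤k)))
        (ℕ.≤-reflexive (ℕ.*-comm (q ℕ.^ n) q)))

  *-cancel-0 : ∀ {g} → ¬ g ≈ 0# → ∀ y → y * g ≈ 0# → y ≈ 0#
  *-cancel-0 {g} g≉0 y eq = small-multiple g (deg g) (deg-HasDegree g g≉0) y λ k _ → coeff≈ eq k

  difference-≉0 : ∀ {x y} → ¬ x ≈ y → ¬ x - y ≈ 0#
  difference-≉0 x≉y eq = x≉y (A.x∙y⁻¹≈ε⇒x≈y _ _ eq)

  newton-regular : ∀ k y → y * newton k (a k) ≈ 0# → y ≈ 0#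
  newton-regular k = prod-regular k λ i i<k →
    *-cancel-0 (difference-≉0 λ eq → ℕ.<⇒≢ i<k (≡.sym (a-injective eq)))

  permute : (f g : F.Carrier → F.Carrier) →
            (∀ {x y} → x F.≈ y → f x F.≈ f y) → (∀ {x y} → x F.≈ y → g x F.≈ g y) →
            (∀ x → f (g x) F.≈ x) → (∀ x → g (f x) F.≈ x) → Permutation q q
  permute f g f-cong g-cong fg gf = permutation
    (λ i → index (f (F.element i))) (λ i → index (g (F.element i)))
    (λ i → index-unique (F.trans (f-cong (element-index _)) (fg _)))
    (λ i → index-unique (F.trans (g-cong (element-index _)) (gf _)))

  const-homo-* : ∀ x y → const x * const y ≈ const (x F.* y)
  const-homo-* x y = ∷-cong (F.+-identityʳ _) A.refl

  const-≉0 : ∀ {x} → ¬ x F.≈ F.0# → ¬ const x ≈ 0#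
  const-≉0 x≉0 eq = x≉0 (coeff≈ eq 0)

  0^q : 0# ^ q ≈ 0#
  0^q = zero-power q 0<q
    where
    zero-power : ∀ n → 0 ℕ.< n → 0# ^ n ≈ 0#
    zero-power (suc n) _ = A.zeroˡ (0# ^ n)

  const-0 : ∀ {x} → x F.≈ F.0# → const x ≈ 0#
  const-0 x≈0 = coeffs≈ λ { zero → x≈0 ; (suc _) → F.refl }

  const^q : ∀ x → const x ^ q ≈ const x
  const^q x with x ≟ F.0#
  ... | yes x≈0 = A.trans (^-congˡ q (const-0 x≈0)) (A.trans 0^q (A.sym (const-0 x≈0)))
  ... | no x≉0 = fermat 0<q (const ∘ F.element) π (const x)
    (λ i i≡0 → index-0 (F.trans (F.*-congˡ (F.element-0 i i≡0)) (F.zeroʳ x)))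
    (λ i 0<i → *-cancel-0 (const-≉0 (element-≉0 i 0<i)))
    (λ i → A.trans (const-homo-* x (F.element i)) (∷-cong (F.sym (element-index _)) A.refl))
    where
    open Fermat F[t]
    y = proj₁ (inverse x x≉0)
    yx≈1 = proj₂ (inverse x x≉0)
    cancelˡ : ∀ {u v} → u F.* v F.≈ F.1# → ∀ z → u F.* (v F.* z) F.≈ z
    cancelˡ eq z = F.trans (F.sym (F.*-assoc _ _ z)) (F.trans (F.*-congʳ eq) (F.*-identityˡ z))
    π = permute (x F.*_) (y F.*_) F.*-congˡ F.*-congˡ
          (cancelˡ (F.trans (F.*-comm x y) yx≈1)) (cancelˡ yx≈1)

  -- Subtracting `x` permutes the constants. This invariance supplies the roots in `frobenius`, so
  -- additivity of the q-th power needs no binomial coefficients.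
  product-translate : ∀ x z → prod (λ j → z + const x - a j) q ≈ newton q z
  product-translate x z = begin
    prod (λ j → z + const x - a j) q              ≈⟨ ∏-prod (λ j → z + const x - a j) q ⟨
    ∏ {q} (λ i → z + const x - a (toℕ i))         ≈⟨ ∏.sum-cong-≋ {q} shift ⟩
    ∏ {q} (λ i → z - a (toℕ (π ⟨$⟩ʳ i)))          ≈⟨ ∏.sum-permute {q} (λ i → z - a (toℕ i)) π ⟨
    ∏ {q} (λ i → z - a (toℕ i))                   ≈⟨ ∏-prod (λ j → z - a j) q ⟩
    newton q z                                    ∎
    where
    module ∏ = Algebra.Properties.CommutativeMonoid.Sum A.*-commutativeMonoid

    π : Permutation q q
    π = permute (F._- x) (F._+ x) F.+-congʳ F.+-congʳ
      (λ y → F.trans (F.+-assoc _ _ _) (F.trans (F.+-congˡ (F.-‿inverseʳ x)) (F.+-identityʳ y)))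
      (λ y → F.trans (F.+-assoc _ _ _) (F.trans (F.+-congˡ (F.-‿inverseˡ x)) (F.+-identityʳ y)))

    shift : ∀ i → z + const x - a (toℕ i) ≈ z - a (toℕ (π ⟨$⟩ʳ i))
    shift i = begin
      z + const x - a (toℕ i)                     ≈⟨ A.+-congˡ (A.-‿cong (a-const i)) ⟩
      z + const x - const (F.element i)
        ≈⟨ solve 3 (λ z x e → z :+ x :- e := z :- (e :- x)) A.refl z (const x) (const (F.element i)) ⟩
      z - (const (F.element i F.- x))             ≈⟨ A.+-congˡ (A.-‿cong (∷-cong (F.sym (element-index _)) A.refl)) ⟩
      z - const (F.element (π ⟨$⟩ʳ i))            ≈⟨ A.+-congˡ (A.-‿cong (a-const (π ⟨$⟩ʳ i))) ⟨
      z - a (toℕ (π ⟨$⟩ʳ i))                      ∎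

  a-<q : ∀ {j} → j ℕ.< q → ∃ λ x → a j ≈ const x
  a-<q j<q = _ , A.trans (A.reflexive (≡.cong a (≡.sym (toℕ-fromℕ< j<q)))) (a-const (fromℕ< j<q))

  a^q : ∀ {j} → j ℕ.< q → a j ^ q ≈ a j
  a^q j<q with a-<q j<q
  ... | x , a≈x = A.trans (^-congˡ q a≈x) (A.trans (const^q x) (A.sym a≈x))

  open Spans F[t] A

  power-monic : Span newton (upTo q) (λ z → z ^ q - newton q z)
  power-monic = span-resp
    (λ z → A.+-congʳ (A.trans (prod-cong q λ _ → A.+-identityʳ z) (prod-const z q)))
    (monic-newton (λ _ → 0#) q)

  -- z ^ q - newton q z - z has degree below q in z and vanishes at all q constants, since c ^ q = c
  -- there.
  newton-q : ∀ z → newton q z ≈ z ^ q - z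
  newton-q z = begin
    newton q z
      ≈⟨ solve 3 (λ n p z → n := p :- z :- (p :- n :- z)) A.refl (newton q z) (z ^ q) z ⟩
    z ^ q - z - (z ^ q - newton q z - z)
      ≈⟨ A.+-congˡ (A.-‿cong (zero-by-roots newton-regular q spanned roots z)) ⟩
    z ^ q - z - 0#
      ≈⟨ solve 1 (λ u → u :- con 0ℤ := u) A.refl (z ^ q - z) ⟩
    z ^ q - z ∎
    where
    spanned : Span newton (upTo q) (λ z → z ^ q - newton q z - z)
    spanned = span-resp
      (λ z → solve 2 (λ u z → u :+ (:- con 1ℤ) :* ((z :+ con 0ℤ) :* con 1ℤ) := u :- z) A.refl
               (z ^ q - newton q z) z)
      -- `2≤q` places the linear term z, of index 1, below q.
      (span-+ power-monic (span-* (- 1#) (linear-newton 0# 0 (∈-upTo⁺ 2≤q) (∈-upTo⁺ 0<q))))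

    roots : ∀ j → j ℕ.< q → a j ^ q - newton q (a j) - a j ≈ 0#
    roots j j<q = begin
      a j ^ q - newton q (a j) - a j ≈⟨ A.+-congʳ (A.+-cong (a^q j<q) (A.-‿cong (newton-root j<q))) ⟩
      a j - 0# - a j                 ≈⟨ solve 1 (λ a → a :- con 0ℤ :- a := con 0ℤ) A.refl (a j) ⟩
      0#                             ∎

  -- The difference of the two sides has degree < q in z and vanishes at the q constants.
  frobenius : ∀ x z → (x + z) ^ q ≈ x ^ q + z ^ q
  frobenius x z = begin
    (x + z) ^ q
      ≈⟨ solve 3 (λ s p r → s := p :+ r :+ (s :- p :- r)) A.refl ((x + z) ^ q) (x ^ q) (z ^ q) ⟩
    x ^ q + z ^ q + ((x + z) ^ q - x ^ q - z ^ q)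
      ≈⟨ A.+-congˡ (zero-by-roots newton-regular q spanned roots z) ⟩
    x ^ q + z ^ q + 0#
      ≈⟨ A.+-identityʳ _ ⟩
    x ^ q + z ^ q ∎
    where
    spanned : Span newton (upTo q) (λ z → (x + z) ^ q - x ^ q - z ^ q)
    spanned = span-resp
      (λ z → A.trans
        (solve 4 (λ s n p r → s :- n :+ ((:- con 1ℤ) :* (p :- n) :+ (:- r) :* con 1ℤ) := s :- r :- p) A.refl
          (prod (λ _ → z + x) q) (newton q z) (z ^ q) (x ^ q))
        (A.+-congʳ (A.+-congʳ (A.trans (prod-const (z + x) q) (^-congˡ q (A.+-comm z x))))))
      (span-+ (monic-newton (λ _ → x) q)
        (span-+ (span-* (- 1#) power-monic) (span-∈ {k = 0} (- (x ^ q)) (∈-upTo⁺ 0<q))))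

    roots : ∀ j → j ℕ.< q → (x + a j) ^ q - x ^ q - a j ^ q ≈ 0#
    roots j j<q with a-<q j<q
    ... | y , a≈y = begin
      (x + a j) ^ q - x ^ q - a j ^ q
        ≈⟨ A.+-cong (A.+-congʳ (^-congˡ q (A.+-congˡ a≈y))) (A.-‿cong (A.trans (a^q j<q) a≈y)) ⟩
      (x + const y) ^ q - x ^ q - const y
        ≈⟨ solve 4 (λ s x r y → s :- r :- y := s :- (x :+ y) :- (r :- x)) A.refl
             ((x + const y) ^ q) x (x ^ q) (const y) ⟩
      (x + const y) ^ q - (x + const y) - (x ^ q - x)
        ≈⟨ A.+-cong (newton-q (x + const y)) (A.-‿cong (newton-q x)) ⟨
      newton q (x + const y) - newton q x
        ≈⟨ A.+-congʳ (product-translate y x) ⟩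
      newton q x - newton q x
        ≈⟨ A.-‿inverseʳ (newton q x) ⟩
      0# ∎

-- Carlitz's additive functions and the divisibility of Newton products.

module Carlitz {c ℓ₁ ℓ₂} (𝔽 : FiniteField c ℓ₁ ℓ₂) where

  open FiniteFieldPolynomials 𝔽
  open FiniteFieldLemmas 𝔽
  open IntegerCoefficients F[t]
  open Products F[t]
  open Newton F[t] a
  open Algebra.Properties.CommutativeSemiring.Exp A.commutativeSemiring using (^-congˡ; ^-distrib-*)
  open Algebra.Properties.CommutativeSemigroup.Divisibility A.*-commutativeSemigroup using (∙-cong-∣; ∣ʳ-respˡ-≈)
  open SetoidReasoning A.setoid

  t : A
  t = F.0# ∷ F.1# ∷ []

  t* : ∀ z → t * z ≈ F.0# ∷ z
  t* z = begin
    t * z                            ≈⟨ ∷-* F.0# 1# z ⟩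
    const F.0# * z + (F.0# ∷ 1# * z) ≈⟨ A.+-cong {const F.0# * z} {0#} (coeffs≈ λ k → F.trans (const-* F.0# z k) (F.zeroˡ _))
                                          (∷-cong F.refl (A.*-identityˡ z)) ⟩
    F.0# ∷ z                         ∎

  ∷≈const+t* : ∀ d z → d ∷ z ≈ const d + t * z
  ∷≈const+t* d z = begin
    d ∷ z                 ≈⟨ ∷-cong (F.sym (F.+-identityʳ d)) A.refl ⟩
    const d + (F.0# ∷ z)  ≈⟨ A.+-congˡ {const d} (t* z) ⟨
    const d + t * z       ∎

  t^q^ : ℕ → A
  t^q^ zero    = t
  t^q^ (suc s) = t^q^ s ^ q

  -- E s z = e z / e (t ^ s) for e z = ∏_{deg b < s} (z - b).
  E : ℕ → A → A
  E zero    z       = z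
  E (suc s) []      = 0#
  E (suc s) (d ∷ z) = t * E (suc s) z + E s z ^ q

  -- Induction on the coefficient list. At a positive level the equation one level down is also
  -- used: its q-th power, expanded by `frobenius`, raises the exponent of t by a factor q.
  E-equation : ∀ s z → (t^q^ (suc s) - t) * E (suc s) z ≈ E s z ^ q - E s z
  E-equation s [] = begin
    (t^q^ (suc s) - t) * 0#  ≈⟨ A.zeroʳ (t^q^ (suc s) - t) ⟩
    0#                       ≈⟨ E[] s ⟨
    E s [] ^ q - E s []      ∎
    where
    0^q-0 : 0# ^ q - 0# ≈ 0#
    0^q-0 = A.trans (A.+-congʳ { - 0#} 0^q) (A.-‿inverseʳ 0#)
    E[] : ∀ s → E s [] ^ q - E s [] ≈ 0#
    E[] zero    = 0^q-0
    E[] (suc _) = 0^q-0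
  E-equation zero (d ∷ z) = begin
    (t ^ q - t) * (t * E 1 z + z ^ q)
      ≈⟨ solve 4 (λ t tq e zq → (tq :- t) :* (t :* e :+ zq) := t :* ((tq :- t) :* e) :+ (tq :- t) :* zq)
           A.refl t (t ^ q) (E 1 z) (z ^ q) ⟩
    t * ((t ^ q - t) * E 1 z) + (t ^ q - t) * z ^ q
      ≈⟨ A.+-congʳ {(t ^ q - t) * z ^ q} (A.*-congˡ {t} (E-equation 0 z)) ⟩
    t * (z ^ q - z) + (t ^ q - t) * z ^ q
      ≈⟨ solve 5 (λ t tq z zq c → t :* (zq :- z) :+ (tq :- t) :* zq := c :+ tq :* zq :- (c :+ t :* z))
           A.refl t (t ^ q) z (z ^ q) (const d) ⟩
    const d + t ^ q * z ^ q - (const d + t * z)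
      ≈⟨ A.+-congʳ { - (const d + t * z)} (A.+-cong (const^q d) (^-distrib-* t z q)) ⟨
    const d ^ q + (t * z) ^ q - (const d + t * z)
      ≈⟨ A.+-congʳ { - (const d + t * z)} (frobenius (const d) (t * z)) ⟨
    (const d + t * z) ^ q - (const d + t * z)
      ≈⟨ A.+-cong (^-congˡ q (∷≈const+t* d z)) (A.-‿cong (∷≈const+t* d z)) ⟨
    (d ∷ z) ^ q - (d ∷ z) ∎
  E-equation (suc s) (d ∷ z) = begin
    (T′ - t) * (t * E (suc (suc s)) z + u ^ q)
      ≈⟨ solve 4 (λ t T e w → (T :- t) :* (t :* e :+ w) := t :* ((T :- t) :* e) :+ (T :- t) :* w)
           A.refl t T′ (E (suc (suc s)) z) (u ^ q) ⟩
    t * ((T′ - t) * E (suc (suc s)) z) + (T′ - t) * u ^ q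
      ≈⟨ A.+-congʳ {(T′ - t) * u ^ q} (A.*-congˡ {t} (E-equation (suc s) z)) ⟩
    t * (u ^ q - u) + (T′ - t) * u ^ q
      ≈⟨ solve 5 (λ t T u w v → t :* (w :- u) :+ (T :- t) :* w := T :* w :+ v :- (t :* u :+ v))
           A.refl t T′ u (u ^ q) (v ^ q) ⟩
    T′ * u ^ q + v ^ q - (t * u + v ^ q)
      ≈⟨ A.+-congʳ { - (t * u + v ^ q)} (begin
        T′ * u ^ q + v ^ q       ≈⟨ A.+-congʳ {v ^ q} (^-distrib-* T u q) ⟨
        (T * u) ^ q + v ^ q      ≈⟨ frobenius (T * u) v ⟨
        (T * u + v) ^ q          ≈⟨ ^-congˡ q IH ⟩
        (t * u + v ^ q) ^ q      ∎) ⟩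
    (t * u + v ^ q) ^ q - (t * u + v ^ q) ∎
    where
    T T′ u v : A
    T  = t^q^ (suc s)
    T′ = t^q^ (suc (suc s))
    u  = E (suc s) z
    v  = E s z
    IH : T * u + v ≈ t * u + v ^ q
    IH = begin
      T * u + v             ≈⟨ solve 4 (λ T t u v → T :* u :+ v := (T :- t) :* u :+ t :* u :+ v) A.refl T t u v ⟩
      (T - t) * u + t * u + v ≈⟨ A.+-congʳ {v} (A.+-congʳ {t * u} (E-equation s z)) ⟩
      v ^ q - v + t * u + v ≈⟨ solve 3 (λ w v x → w :- v :+ x :+ v := x :+ w) A.refl (v ^ q) v (t * u) ⟩
      t * u + v ^ q         ∎

  E-+ : ∀ s z w → E s (z + w) ≈ E s z + E s w
  E-+ zero    z       w       = A.refl
  E-+ (suc s) []      w       = A.sym (A.+-identityˡ (E (suc s) w))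
  E-+ (suc s) (d ∷ z) []      = A.sym (A.+-identityʳ (E (suc s) (d ∷ z)))
  E-+ (suc s) (d ∷ z) (e ∷ w) = begin
    t * E (suc s) (z + w) + E s (z + w) ^ q
      ≈⟨ A.+-cong (A.*-congˡ {t} (E-+ (suc s) z w)) (A.trans (^-congˡ q (E-+ s z w)) (frobenius (E s z) (E s w))) ⟩
    t * (E (suc s) z + E (suc s) w) + (E s z ^ q + E s w ^ q)
      ≈⟨ solve 5 (λ t a b c d → t :* (a :+ b) :+ (c :+ d) := t :* a :+ c :+ (t :* b :+ d)) A.refl
           t (E (suc s) z) (E (suc s) w) (E s z ^ q) (E s w ^ q) ⟩
    t * E (suc s) z + E s z ^ q + (t * E (suc s) w + E s w ^ q) ∎

  E-step-0 : ∀ s d z → E (suc s) z ≈ 0# → E s z ≈ 0# → E (suc s) (d ∷ z) ≈ 0#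
  E-step-0 s d z eq eq′ = begin
    t * E (suc s) z + E s z ^ q  ≈⟨ A.+-cong (A.*-congˡ {t} eq) (A.trans (^-congˡ q eq′) 0^q) ⟩
    t * 0# + 0#                  ≈⟨ solve 1 (λ t → t :* con 0ℤ :+ con 0ℤ := con 0ℤ) A.refl t ⟩
    0#                           ∎

  E-0 : ∀ s z → z ≈ 0# → E s z ≈ 0#
  E-0 zero    z       eq = eq
  E-0 (suc s) []      eq = A.refl
  E-0 (suc s) (d ∷ z) eq = E-step-0 s d z (E-0 (suc s) z eq′) (E-0 s z eq′)
    where
    eq′ : z ≈ 0#
    eq′ = coeffs≈ (coeff≈ eq ∘ suc)

  -- `E` recurses on lists, and equal polynomials may differ in trailing zeros, so congruence is
  -- drawn from additivity and `E-0`.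
  E-cong : ∀ s {z w} → z ≈ w → E s z ≈ E s w
  E-cong s {z} {w} z≈w = begin
    E s z                          ≈⟨ A.+-identityʳ (E s z) ⟨
    E s z + 0#                     ≈⟨ A.+-congˡ {E s z} (E-inverse w) ⟨
    E s z + (E s w + E s (- w))    ≈⟨ solve 3 (λ a b c → a :+ (b :+ c) := b :+ (a :+ c)) A.refl (E s z) (E s w) (E s (- w)) ⟩
    E s w + (E s z + E s (- w))    ≈⟨ A.+-congˡ {E s w} (E-+ s z (- w)) ⟨
    E s w + E s (z - w)            ≈⟨ A.+-congˡ {E s w} (E-0 s (z - w) (A.trans (A.+-congʳ { - w} z≈w) (A.-‿inverseʳ w))) ⟩
    E s w + 0#                     ≈⟨ A.+-identityʳ (E s w) ⟩
    E s w                          ∎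
    where
    E-inverse : ∀ w → E s w + E s (- w) ≈ 0#
    E-inverse w = A.trans (A.sym (E-+ s w (- w))) (E-0 s (w - w) (A.-‿inverseʳ w))

  shift : ℕ → A → A
  shift zero    z = z
  shift (suc s) z = F.0# ∷ shift s z

  shift-cong : ∀ s {z w} → z ≈ w → shift s z ≈ shift s w
  shift-cong zero    eq = eq
  shift-cong (suc s) eq = ∷-cong F.refl (shift-cong s eq)

  shift-∷ : ∀ s d z → shift s (d ∷ z) ≈ shift s (const d) + shift (suc s) z
  shift-∷ zero    d z = ∷-cong (F.sym (F.+-identityʳ d)) A.refl
  shift-∷ (suc s) d z = ∷-cong (F.sym (F.+-identityʳ F.0#)) (shift-∷ s d z)

  E-short : ∀ s z → length z ℕ.≤ s → E s z ≈ 0#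
  E-short zero    []      _          = A.refl
  E-short (suc s) []      _          = A.refl
  E-short (suc s) (d ∷ z) (s≤s ∣z∣≤s) = E-step-0 s d z (E-short (suc s) z (ℕ.m≤n⇒m≤1+n ∣z∣≤s)) (E-short s z ∣z∣≤s)

  length-shift : ∀ s d → length (shift s (const d)) ≡ suc s
  length-shift zero    d = ≡.refl
  length-shift (suc s) d = ≡.cong suc (length-shift s d)

  -- The normalisation E s (t ^ s) = 1, extended to constants: in the recursion the linear term dies
  -- by `E-short`, and the q-th power fixes `d`.
  E-shift-const : ∀ s d → E s (shift s (const d)) ≈ const d
  E-shift-const zero    d = A.refl
  E-shift-const (suc s) d = begin
    t * E (suc s) (shift s (const d)) + E s (shift s (const d)) ^ q
      ≈⟨ A.+-cong (A.*-congˡ {t} (E-short (suc s) (shift s (const d)) (ℕ.≤-reflexive (length-shift s d))))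
           (A.trans (^-congˡ q (E-shift-const s d)) (const^q d)) ⟩
    t * 0# + const d  ≈⟨ solve 2 (λ t d → t :* con 0ℤ :+ d := d) A.refl t (const d) ⟩
    const d           ∎

  -- At level 0 this is `x - a j`, so `prod (θ 0 x) k` is `newton k x`.
  θ : ℕ → A → ℕ → A
  θ s x j = E s (shift s (x - a j))

  θ-cong : ∀ s {x y} → x ≈ y → ∀ j → θ s x j ≈ θ s y j
  θ-cong s x≈y j = E-cong s (shift-cong s (A.+-congʳ { - a j} x≈y))

  -- The difference inside is (d - e) + t (y - a j), with e the element numbered i. The factor t
  -- becomes one more shift, and `E s` returns the constant d - e from its shifted copy.
  θ-digits : ∀ s d y j {i} → i ℕ.< q →
    θ s (d ∷ y) (j ℕ.* q ℕ.+ i) ≈ E s (shift (suc s) (y - a j)) + const d - a i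
  θ-digits s d y j {i} i<q = begin
    E s (shift s ((d ∷ y) - a (j ℕ.* q ℕ.+ i)))
      ≈⟨ E-cong s (shift-cong s (A.+-congˡ {d ∷ y} (A.-‿cong a≈))) ⟩
    E s (shift s ((d F.- e) ∷ (y - a j)))
      ≈⟨ E-cong s (shift-∷ s (d F.- e) (y - a j)) ⟩
    E s (shift s (const (d F.- e)) + shift (suc s) (y - a j))
      ≈⟨ E-+ s (shift s (const (d F.- e))) (shift (suc s) (y - a j)) ⟩
    E s (shift s (const (d F.- e))) + v
      ≈⟨ A.+-congʳ {v} (E-shift-const s (d F.- e)) ⟩
    const d - const e + v
      ≈⟨ solve 3 (λ d e v → d :- e :+ v := v :+ d :- e) A.refl (const d) (const e) v ⟩
    v + const d - const e
      ≈⟨ A.+-congˡ {v + const d} (A.-‿cong ai≈) ⟨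
    v + const d - a i ∎
    where
    e : F.Carrier
    e = F.element (fromℕ< i<q)
    v : A
    v = E s (shift (suc s) (y - a j))
    ai≈ : a i ≈ const e
    ai≈ = proj₂ (a-<q i<q)
    a≈ : a (j ℕ.* q ℕ.+ i) ≈ e ∷ a j
    a≈ = A.trans (A.reflexive (≡.cong a (≡.trans (ℕ.+-comm (j ℕ.* q) i)
      (≡.cong (ℕ._+ j ℕ.* q) (≡.sym (toℕ-fromℕ< i<q)))))) (a-digits (fromℕ< i<q) j)

  θ-block : ∀ s d y j →
    prod (λ i → θ s (d ∷ y) (j ℕ.* q ℕ.+ i)) q ≈ (t^q^ (suc s) - t) * θ (suc s) y j
  θ-block s d y j = begin
    prod (λ i → θ s (d ∷ y) (j ℕ.* q ℕ.+ i)) q ≈⟨ prod-cong-< q (λ i → θ-digits s d y j) ⟩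
    prod (λ i → v + const d - a i) q           ≈⟨ product-translate d v ⟩
    newton q v                                 ≈⟨ newton-q v ⟩
    v ^ q - v                                  ≈⟨ E-equation s (shift (suc s) (y - a j)) ⟨
    (t^q^ (suc s) - t) * θ (suc s) y j         ∎
    where
    v : A
    v = E s (shift (suc s) (y - a j))

  θ-split : ∀ s d y k i → i ℕ.≤ q → prod (θ s (d ∷ y)) (k ℕ.* q ℕ.+ i) ≈
    prod (λ _ → t^q^ (suc s) - t) k * prod (θ (suc s) y) k *
      prod (λ j → E s (shift (suc s) (y - a k)) + const d - a j) i
  θ-split s d y k i i≤q = begin
    prod (θ s (d ∷ y)) (k ℕ.* q ℕ.+ i)
      ≈⟨ prod-+ (θ s (d ∷ y)) (k ℕ.* q) i ⟩
    prod (θ s (d ∷ y)) (k ℕ.* q) * prod (λ j → θ s (d ∷ y) (k ℕ.* q ℕ.+ j)) i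
      ≈⟨ A.*-cong
           (A.trans (prod-blocks (θ s (d ∷ y)) q k) (A.trans (prod-cong k (θ-block s d y))
             (prod-* (λ _ → t^q^ (suc s) - t) (θ (suc s) y) k)))
           (prod-cong-< i λ j j<i → θ-digits s d y k (ℕ.≤-trans j<i i≤q)) ⟩
    _ ∎

  unit-∣ : ∀ {u} v → u ∣ 1# → u ∣ v
  unit-∣ {u} v (w , wu≈1) = v * w , (begin
    v * w * u    ≈⟨ A.*-assoc v w u ⟩
    v * (w * u)  ≈⟨ A.*-congˡ {v} wu≈1 ⟩
    v * 1#       ≈⟨ A.*-identityʳ v ⟩
    v            ∎)

  prod-unit : ∀ (u : ℕ → A) n → (∀ i → i ℕ.< n → u i ∣ 1#) → prod u n ∣ 1#
  prod-unit u zero    _    = 1# , A.*-identityˡ 1#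
  prod-unit u (suc n) unit = ∣-resp (A.*-identityˡ 1#)
    (∙-cong-∣ (prod-unit u n λ i i<n → unit i (ℕ.m<n⇒m<1+n i<n)) (unit n ℕ.≤-refl))

  const-unit : ∀ {x} → ¬ x F.≈ F.0# → const x ∣ 1#
  const-unit {x} x≉0 = const y , A.trans (const-homo-* y x) (∷-cong yx≈1 A.refl)
    where
    y = proj₁ (inverse x x≉0)
    yx≈1 = proj₂ (inverse x x≉0)

  a-difference-unit : ∀ {i j} → i ℕ.< j → j ℕ.< q → a j - a i ∣ 1#
  a-difference-unit {i} {j} i<j j<q = ∣ʳ-respˡ-≈ (A.sym eq) (const-unit λ x-y≈0 → ℕ.<⇒≢ i<j
      (≡.sym (a-injective (A.x∙y⁻¹≈ε⇒x≈y (a j) (a i)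
        (A.trans eq (const-0 x-y≈0))))))
    where
    x = proj₁ (a-<q j<q)
    y = proj₁ (a-<q (ℕ.<-trans i<j j<q))
    eq : a j - a i ≈ const (x F.- y)
    eq = A.+-cong (proj₂ (a-<q j<q)) (A.-‿cong (proj₂ (a-<q (ℕ.<-trans i<j j<q))))

  θ-divisibility : ∀ k s x → prod (θ s (a k)) k ∣ prod (θ s x) k
  θ-divisibility = <-rec _ step
    where
    instance
      q≢0 : NonZero q
      q≢0 = ℕ.>-nonZero 0<q

    Claim : ℕ → Set _
    Claim k = ∀ s x → prod (θ s (a k)) k ∣ prod (θ s x) k

    digit-step : ∀ i k → i ℕ.< q → Claim k → ∀ s d y →
      prod (θ s (a (i ℕ.+ k ℕ.* q))) (k ℕ.* q ℕ.+ i) ∣ prod (θ s (d ∷ y)) (k ℕ.* q ℕ.+ i)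
    digit-step i k i<q IH s d y =
      ∣-resp (A.sym (θ-split s d y k i (ℕ.<⇒≤ i<q))) (∣ʳ-respˡ-≈ (A.sym dividend) divides)
      where
      e : F.Carrier
      e = F.element (fromℕ< i<q)

      v : A
      v = E s (shift (suc s) (a k - a k))

      v≈0 : v ≈ 0#
      v≈0 = begin
        E s (shift (suc s) (a k - a k)) ≈⟨ E-cong s (shift-cong (suc s) (A.-‿inverseʳ (a k))) ⟩
        E s (shift (suc s) 0#)          ≈⟨ E-0 s (shift (suc s) 0#) (shift-0 (suc s)) ⟩
        0#                              ∎
        where
        shift-0 : ∀ s → shift s 0# ≈ 0#
        shift-0 zero    = A.refl
        shift-0 (suc s) = coeffs≈ λ { zero → F.refl ; (suc n) → coeff≈ (shift-0 s) n }

      a≈ : a (i ℕ.+ k ℕ.* q) ≈ e ∷ a k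
      a≈ = A.trans (A.reflexive (≡.cong (λ i → a (i ℕ.+ k ℕ.* q)) (≡.sym (toℕ-fromℕ< i<q)))) (a-digits (fromℕ< i<q) k)

      top : ∀ j → v + const e - a j ≈ a i - a j
      top j = A.+-congʳ { - a j} (begin
        v + const e   ≈⟨ A.+-cong v≈0 (A.sym (proj₂ (a-<q i<q))) ⟩
        0# + a i      ≈⟨ A.+-identityˡ (a i) ⟩
        a i           ∎)

      B : A
      B = prod (λ _ → t^q^ (suc s) - t) k

      dividend : prod (θ s (a (i ℕ.+ k ℕ.* q))) (k ℕ.* q ℕ.+ i) ≈
                 B * prod (θ (suc s) (a k)) k * prod (λ j → a i - a j) i
      dividend = begin
        prod (θ s (a (i ℕ.+ k ℕ.* q))) (k ℕ.* q ℕ.+ i)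
          ≈⟨ prod-cong (k ℕ.* q ℕ.+ i) (θ-cong s a≈) ⟩
        prod (θ s (e ∷ a k)) (k ℕ.* q ℕ.+ i)
          ≈⟨ θ-split s e (a k) k i (ℕ.<⇒≤ i<q) ⟩
        B * prod (θ (suc s) (a k)) k * prod (λ j → v + const e - a j) i
          ≈⟨ A.*-congˡ {B * prod (θ (suc s) (a k)) k} (prod-cong i top) ⟩
        B * prod (θ (suc s) (a k)) k * prod (λ j → a i - a j) i ∎

      divides : B * prod (θ (suc s) (a k)) k * prod (λ j → a i - a j) i ∣
        B * prod (θ (suc s) y) k * prod (λ j → E s (shift (suc s) (y - a k)) + const d - a j) i
      divides = ∙-cong-∣
        {B * prod (θ (suc s) (a k)) k} {B * prod (θ (suc s) y) k}
        {prod (λ j → a i - a j) i} {prod (λ j → E s (shift (suc s) (y - a k)) + const d - a j) i}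
        (∙-cong-∣ {B} {B} {prod (θ (suc s) (a k)) k} {prod (θ (suc s) y) k}
          (1# , A.*-identityˡ B) (IH (suc s) y))
        (unit-∣ {prod (λ j → a i - a j) i} (prod (λ j → E s (shift (suc s) (y - a k)) + const d - a j) i)
          (prod-unit (λ j → a i - a j) i λ j j<i → a-difference-unit j<i i<q))

    cons-step : ∀ k → (∀ {j} → j ℕ.< suc k → Claim j) → ∀ s d y →
                prod (θ s (a (suc k))) (suc k) ∣ prod (θ s (d ∷ y)) (suc k)
    cons-step k-1 IH s d y = ≡.subst₂ (λ m n → prod (θ s (a m)) n ∣ prod (θ s (d ∷ y)) n)
      (≡.sym k≡) (≡.trans (ℕ.+-comm (k ℕ./ q ℕ.* q) (k ℕ.% q)) (≡.sym k≡))
      (digit-step (k ℕ.% q) (k ℕ./ q) (m%n<n k q) (IH (m/n<m k q 2≤q)) s d y)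
      where
      k : ℕ
      k = suc k-1
      k≡ : k ≡ k ℕ.% q ℕ.+ k ℕ./ q ℕ.* q
      k≡ = m≡m%n+[m/n]*n k q

    step : ∀ k → (∀ {j} → j ℕ.< k → Claim j) → Claim k
    step zero    _  s x       = 1# , A.*-identityˡ 1#
    -- The empty list has no last digit to split off, so it is replaced by the equal polynomial
    -- `F.0# ∷ []`.
    step (suc k) IH s []      =
      ∣-resp (prod-cong (suc k) (θ-cong s {F.0# ∷ []} {[]} (const-0 F.refl)))
        (cons-step k IH s F.0# [])
    step (suc k) IH s (d ∷ y) = cons-step k IH s d y

  newton-∣ : ∀ k x → newton k (a k) ∣ newton k x
  newton-∣ k x = θ-divisibility k 0 x

-- The quotient ring modulo g, on the same carrier.

module Quotient {c ℓ} (R : CommutativeRing c ℓ) (g : CommutativeRing.Carrier R) where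

  open CommutativeRing R
  open IntegerCoefficients R
  open Divisibility R
  private module S = Setoid (quotientSetoid g)

  infix 4 _≈ᵍ_
  -- A bare congruence unfolds to a divisibility of `x - y`, from which `x` and `y` are not
  -- recoverable by inference; the record keeps them as indices.
  record _≈ᵍ_ (x y : Carrier) : Set (c ⊔ ℓ) where
    constructor mod
    field difference : x ≡ y mod g
  open _≈ᵍ_ public

  ≈⇒≈ᵍ : ∀ {x y} → x ≈ y → x ≈ᵍ y
  ≈⇒≈ᵍ {x} {y} eq = mod (0# , trans (zeroˡ g) (sym (trans (+-congʳ eq) (-‿inverseʳ y))))

  ∣⇒≈ᵍ0 : ∀ {x} → g ∣ x → x ≈ᵍ 0#
  ∣⇒≈ᵍ0 {x} g∣x = mod (∣-resp (solve 1 (λ x → x := x :- con 0ℤ) refl x) g∣x)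

  quotientRing : CommutativeRing c (c ⊔ ℓ)
  quotientRing = record
    { Carrier = Carrier ; _≈_ = _≈ᵍ_ ; _+_ = _+_ ; _*_ = _*_ ; -_ = -_ ; 0# = 0# ; 1# = 1#
    ; isCommutativeRing = record
      { isRing = record
        { +-isAbelianGroup = record
          { isGroup = record
            { isMonoid = record
              { isSemigroup = record
                { isMagma = record
                  { isEquivalence = record
                    { refl  = ≈⇒≈ᵍ refl
                    ; sym   = λ {x} {y} (mod eq) → mod (S.sym {x} {y} eq)
                    ; trans = λ {x} {y} {z} (mod eq) (mod eq′) → mod (S.trans {x} {y} {z} eq eq′)
                    }
                  ; ∙-cong = λ {x} {y} {u} {v} (mod eq) (mod eq′) → mod (∣-resp
                      (solve 4 (λ x y u v → x :- y :+ (u :- v) := x :+ u :- (y :+ v)) refl x y u v)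
                      (∣-+ eq eq′))
                  }
                ; assoc = λ x y z → ≈⇒≈ᵍ (+-assoc x y z)
                }
              ; identity = (λ x → ≈⇒≈ᵍ (+-identityˡ x)) , λ x → ≈⇒≈ᵍ (+-identityʳ x)
              }
            ; inverse = (λ x → ≈⇒≈ᵍ (-‿inverseˡ x)) , λ x → ≈⇒≈ᵍ (-‿inverseʳ x)
            ; ⁻¹-cong = λ {x} {y} (mod eq) → mod (∣-resp
                (solve 2 (λ x y → :- (x :- y) := :- x :- :- y) refl x y) (∣-neg eq))
            }
          ; comm = λ x y → ≈⇒≈ᵍ (+-comm x y)
          }
        ; *-cong = λ {x} {y} {u} {v} (mod eq) (mod eq′) → mod (∣-resp
            (solve 4 (λ x y u v → u :* (x :- y) :+ y :* (u :- v) := x :* u :- y :* v) refl x y u v)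
            (∣-+ (∣-* u eq) (∣-* y eq′)))
        ; *-assoc    = λ x y z → ≈⇒≈ᵍ (*-assoc x y z)
        ; *-identity = (λ x → ≈⇒≈ᵍ (*-identityˡ x)) , λ x → ≈⇒≈ᵍ (*-identityʳ x)
        ; distrib    = (λ x y z → ≈⇒≈ᵍ (distribˡ x y z)) , λ x y z → ≈⇒≈ᵍ (distribʳ x y z)
        }
      ; *-comm = λ x y → ≈⇒≈ᵍ (*-comm x y)
      }
    }

  span-mod : ∀ {x y} {X : Set x} {Y : Set y} {K : Set} {β : K → Y → Carrier} {ks θ} (h : X → Y) →
    Spans.Span R Y β ks θ → Spans.Span quotientRing X (λ k p → β k (h p)) ks (θ ∘ h)
  span-mod h (Spans.[] θ≈0) = Spans.[] λ p → ≈⇒≈ᵍ (θ≈0 (h p))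
  span-mod h (a Spans.∷ s)  = a Spans.∷ span-mod h s

  private module Q = CommutativeRing quotientRing

  -- The discarded part contributes s * (h * w), a multiple of g. So a coefficient of `w` matters
  -- only modulo `h`.
  reduce-coefficient : ∀ {u s h v w} → u ≈ s * h + v → g ∣ h * w → v * w ≈ᵍ u * w
  reduce-coefficient {u} {s} {h} {v} {w} u≈ g∣hw = Q.sym (Q.trans
    (≈⇒≈ᵍ (trans (*-congʳ u≈)
      (solve 4 (λ s h v w → (s :* h :+ v) :* w := s :* (h :* w) :+ v :* w) refl s h v w)))
    (Q.trans (Q.+-congʳ {v * w} (∣⇒≈ᵍ0 (∣-* s g∣hw))) (Q.+-identityˡ (v * w))))

  difference-∣ : ∀ {x y w w′} → w ≈ w′ → x * w ≈ᵍ y * w → g ∣ (x - y) * w′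
  difference-∣ {x} {y} {w} w≈w′ eq = ∣-resp
    (trans (solve 3 (λ x y w → x :* w :- y :* w := (x :- y) :* w) refl x y w) (*-congˡ w≈w′))
    (difference eq)

-- Cofactors of greatest common divisors.

module GCDs {c ℓ₁ ℓ₂} (𝔽 : FiniteField c ℓ₁ ℓ₂) where

  open FiniteFieldPolynomials 𝔽
  open FiniteFieldLemmas 𝔽
  open IntegerCoefficients F[t]
  open SetoidReasoning A.setoid

  *-cancelʳ : ∀ {d} → ¬ d ≈ 0# → ∀ {x y} → x * d ≈ y * d → x ≈ y
  *-cancelʳ {d} d≉0 {x} {y} eq = A.x∙y⁻¹≈ε⇒x≈y x y (*-cancel-0 d≉0 (x - y) (begin
    (x - y) * d    ≈⟨ solve 3 (λ x y d → (x :- y) :* d := x :* d :- y :* d) A.refl x y d ⟩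
    x * d - y * d  ≈⟨ A.+-congʳ { - (y * d)} eq ⟩
    y * d - y * d  ≈⟨ A.-‿inverseʳ (y * d) ⟩
    0#             ∎))

  /gcd-* : ∀ g y → (g /gcd y) * gcd g y ≈ g
  /gcd-* g y = _∣ʳ_.equality (IsGCD.d∣x (gcd-isGCD g y))

  /gcd-≉0 : ∀ {g} y → ¬ g ≈ 0# → ¬ g /gcd y ≈ 0#
  /gcd-≉0 {g} y g≉0 eq = g≉0 (begin
    g                      ≈⟨ /gcd-* g y ⟨
    (g /gcd y) * gcd g y   ≈⟨ A.*-congʳ {gcd g y} eq ⟩
    0# * gcd g y           ≈⟨ A.zeroˡ (gcd g y) ⟩
    0#                     ∎)

  gcd-≉0 : ∀ {g} y → ¬ g ≈ 0# → ¬ gcd g y ≈ 0#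
  gcd-≉0 {g} y g≉0 eq = g≉0 (begin
    g                      ≈⟨ /gcd-* g y ⟨
    (g /gcd y) * gcd g y   ≈⟨ A.*-congˡ {g /gcd y} eq ⟩
    (g /gcd y) * 0#        ≈⟨ A.zeroʳ (g /gcd y) ⟩
    0#                     ∎)

  -- With y = v * gcd g y, the product (g /gcd y) * y is v * g. Hence changing a coefficient by a
  -- multiple of g /gcd y leaves the function unchanged modulo g.
  ∣-/gcd-* : ∀ g {y z} → y ∣ z → g ∣ (g /gcd y) * z
  ∣-/gcd-* g {y} {z} (m , my≈z) with IsGCD.d∣y (gcd-isGCD g y)
  ... | v , vd≈y = m * v , (begin
    m * v * g                        ≈⟨ A.*-congˡ {m * v} (/gcd-* g y) ⟨
    m * v * ((g /gcd y) * gcd g y)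
      ≈⟨ solve 4 (λ m v h d → m :* v :* (h :* d) := h :* (m :* (v :* d))) A.refl m v (g /gcd y) (gcd g y) ⟩
    (g /gcd y) * (m * (v * gcd g y)) ≈⟨ A.*-congˡ {g /gcd y} (A.*-congˡ {m} vd≈y) ⟩
    (g /gcd y) * (m * y)             ≈⟨ A.*-congˡ {g /gcd y} my≈z ⟩
    (g /gcd y) * z                   ∎)

  -- gcd (x g) (x y) is x times a common divisor of g and y, which gives Gauss's lemma
  -- without Bézout coefficients.
  /gcd-∣ : ∀ {g} y → ¬ g ≈ 0# → ∀ x → g ∣ x * y → g /gcd y ∣ x
  /gcd-∣ {g} y g≉0 x g∣xy with x ≈0?
  ... | yes x≈0 = 0# , A.trans (A.zeroˡ (g /gcd y)) (A.sym x≈0)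
  ... | no  x≉0 = conclude x∣e (IsGCD.greatest isGCD (∣-* x (1# , A.*-identityˡ g)) g∣xy)
    where
    isGCD = gcd-isGCD (x * g) (x * y)

    e h d : A
    e = gcd (x * g) (x * y)
    h = g /gcd y
    d = gcd g y

    x∣e : x ∣ e
    x∣e = IsGCD.greatest isGCD (g , A.*-comm g x) (y , A.*-comm y x)

    conclude : x ∣ e → g ∣ e → h ∣ x
    conclude (e′ , e′x≈e) (n , ng≈e) = finish (IsGCD.greatest (gcd-isGCD g y) (cofactor (IsGCD.d∣x isGCD))
                                                 (cofactor (IsGCD.d∣y isGCD)))
      where
      cofactor : ∀ {z} → e ∣ x * z → e′ ∣ z
      cofactor {z} (w , we≈xz) = w , *-cancelʳ x≉0 (begin
        w * e′ * x    ≈⟨ A.*-assoc w e′ x ⟩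
        w * (e′ * x)  ≈⟨ A.*-congˡ {w} e′x≈e ⟩
        w * e         ≈⟨ we≈xz ⟩
        x * z         ≈⟨ A.*-comm x z ⟩
        z * x         ∎)

      finish : e′ ∣ d → h ∣ x
      finish (m , me′≈d) = m * n , *-cancelʳ (gcd-≉0 y g≉0) (begin
        m * n * h * d    ≈⟨ solve 4 (λ m n h d → m :* n :* h :* d := m :* (n :* (h :* d))) A.refl m n h d ⟩
        m * (n * (h * d)) ≈⟨ A.*-congˡ {m} (A.*-congˡ {n} (/gcd-* g y)) ⟩
        m * (n * g)      ≈⟨ A.*-congˡ {m} (A.trans ng≈e (A.sym e′x≈e)) ⟩
        m * (e′ * x)     ≈⟨ A.*-assoc m e′ x ⟨
        m * e′ * x       ≈⟨ A.*-congʳ {x} me′≈d ⟩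
        d * x            ≈⟨ A.*-comm d x ⟩
        x * d            ∎)

  small-∣⇒≈0 : ∀ {h p} → ¬ h ≈ 0# → h ∣ p → VanishesFrom (deg h) p → p ≈ 0#
  small-∣⇒≈0 {h} {p} h≉0 (u , uh≈p) small = begin
    p      ≈⟨ uh≈p ⟨
    u * h  ≈⟨ A.*-congʳ {h} (small-multiple h (deg h) (deg-HasDegree h h≉0) u
                λ k n≤k → F.trans (coeff≈ uh≈p k) (small k n≤k)) ⟩
    0# * h ≈⟨ A.zeroˡ h ⟩
    0#     ∎

-- The order of the box.

-- Weaker than lexicographic order and not transitive, but it holds between each entry of `box` and
-- every later one, and a single increasing coordinate already makes the later Newton product vanish
-- at the earlier corner.
_⊏_ : ∀ {r} → Vector ℕ r → Vector ℕ r → Set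
k ⊏ k′ = ∃ λ i → k i ℕ.< k′ i

box-sorted : ∀ {r} (m : Vector ℕ r) → AllPairs _⊏_ (box m)
box-sorted {zero}  m = [] ∷ []
box-sorted {suc r} m = rows (upTo (Vector.head m)) (AllPairs.applyUpTo⁺₁ id (Vector.head m) λ i<j _ → i<j)
  where
  tails = box (Vector.tail m)

  later : ∀ {x} k xs → All (x ℕ.<_) xs → All ((x Vector.∷ k) ⊏_) (cartesianProductWith Vector._∷_ xs tails)
  later k []       []         = []
  later k (y ∷ xs) (x<y ∷ x<) = All.++⁺ (All.map⁺ (All.universal (λ _ → Fin.zero , x<y) tails)) (later k xs x<)

  rows : ∀ xs → AllPairs ℕ._<_ xs → AllPairs _⊏_ (cartesianProductWith Vector._∷_ xs tails)
  rows []       []         = []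
  rows (x ∷ xs) (x< ∷ xs<) = AllPairs.++⁺
    (AllPairs.map⁺ (AllPairs.map (λ (i , lt) → Fin.suc i , lt) (box-sorted (Vector.tail m))))
    (rows xs xs<)
    (All.map⁺ (All.universal (λ k → later k xs x<) tails))

box-bounded : ∀ {r} (m : Vector ℕ r) → All (λ k → ∀ i → k i ℕ.< m i) (box m)
box-bounded {zero}  m = (λ ()) ∷ []
box-bounded {suc r} m = rows (upTo (Vector.head m)) (All.applyUpTo⁺₁ id (Vector.head m) id)
  where
  rows : ∀ xs → All (ℕ._< Vector.head m) xs →
         All (λ k → ∀ i → k i ℕ.< m i) (cartesianProductWith Vector._∷_ xs (box (Vector.tail m)))
  rows []       []         = []
  rows (x ∷ xs) (x< ∷ xs<) = All.++⁺
    (All.map⁺ (All.map (λ k< → λ { Fin.zero → x< ; (Fin.suc i) → k< i }) (box-bounded (Vector.tail m))))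
    (rows xs xs<)

-- Polynomial functions as Newton combinations modulo g.

module QuotientSpans {c ℓ x} (R : CommutativeRing c ℓ) (g : CommutativeRing.Carrier R)
                     (a : ℕ → CommutativeRing.Carrier R) (X : Set x) where

  open CommutativeRing R using (Carrier; _*_; _+_; 0#; 1#; semiring)
  open RawSemiringDefs (Semiring.rawSemiring semiring) using (_^_) renaming (product to ∏)
  open Newton R a
  open Quotient R g
  open Spans quotientRing X
  private module Q = CommutativeRing quotientRing

  -- Points stay in an arbitrary `X` with `b` reading off coordinates, so an induction on r drops a
  -- coordinate without changing the set of points.
  newtons monomials : ∀ {r} → (X → Vector Carrier r) → Vector ℕ r → X → Carrier
  newtons   b k p = ∏ λ i → newton (k i) (b p i)
  monomials b e p = ∏ λ i → b p i ^ e i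

  -- Newton products of index at least m are zero modulo g and drop out. The multiplier `1#` is
  -- there only to let `span-map` exchange the index list.
  power-span : ∀ (b : X → Carrier) m → (∀ j → m ℕ.≤ j → ∀ p → newton j (b p) ≈ᵍ 0#) → ∀ n →
    Span (λ j p → newton j (b p)) (upTo m) (λ p → b p ^ n)
  power-span b m vanishes n = span-resp (λ p → Q.*-identityˡ (b p ^ n))
    (span-map (λ _ → 1#) (All.universal basis (proj₁ (power-in-newtons n)))
      (span-mod b (proj₂ (power-in-newtons n))))
    where
    basis : ∀ j → Span (λ j p → newton j (b p)) (upTo m) (λ p → 1# * newton j (b p))
    basis j with j ℕ.<? m
    ... | yes j<m = span-∈ 1# (∈-upTo⁺ j<m)
    ... | no  j≮m = span-0 λ p →
      Q.trans (Q.*-identityˡ (newton j (b p))) (vanishes j (ℕ.≮⇒≥ j≮m) p)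

  NewtonsVanish : ∀ {r} → (X → Vector Carrier r) → Vector ℕ r → Set _
  NewtonsVanish b m = ∀ i j → m i ℕ.≤ j → ∀ p → newton j (b p i) ≈ᵍ 0#

  monomial-span : ∀ {r} (b : X → Vector Carrier r) (m : Vector ℕ r) → NewtonsVanish b m → ∀ e →
    Span (newtons b) (box m) (monomials b e)
  monomial-span {zero}  b m vanish e = span-resp (λ _ → Q.*-identityˡ 1#) (span-∈ 1# (here ≡.refl))
  monomial-span {suc r} b m vanish e = span-⊗ Vector._∷_ (λ _ _ _ → Q.refl)
    (power-span (λ p → b p Fin.zero) (m Fin.zero) (vanish Fin.zero) (e Fin.zero))
    (monomial-span (λ p → b p ∘ Fin.suc) (m ∘ Fin.suc) (vanish ∘ Fin.suc) (e ∘ Fin.suc))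

  newtons-span : ∀ {r} (b : X → Vector Carrier r) k → ∃ λ es → Span (monomials b) es (newtons b k)
  newtons-span {zero}  b k = _ , span-resp (λ _ → Q.*-identityˡ 1#) (span-∈ {k = k} 1# (here {xs = []} ≡.refl))
  newtons-span {suc r} b k = _ , span-⊗ Vector._∷_ (λ _ _ _ → Q.refl)
    (span-mod (λ p → b p Fin.zero) (proj₂ (newton-in-powers (k Fin.zero))))
    (proj₂ (newtons-span (λ p → b p ∘ Fin.suc) (k ∘ Fin.suc)))

  -- Over A this unfolds to the same term as `eval`, so its congruences apply to `IsPolynomial`
  -- directly.
  evaluate : ∀ {r} → List (Carrier × Vector ℕ r) → Vector Carrier r → Carrier
  evaluate P b = List.foldr _+_ 0# (map (λ (u , e) → u * ∏ λ i → b i ^ e i) P)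

  evaluate-span : ∀ {r} (b : X → Vector Carrier r) (m : Vector ℕ r) → NewtonsVanish b m → ∀ P →
    Span (newtons b) (box m) (λ p → evaluate P (b p))
  evaluate-span b m vanish []            = span-0 λ _ → Q.refl
  evaluate-span b m vanish ((u , e) ∷ P) =
    span-+ (span-* u (monomial-span b m vanish e)) (evaluate-span b m vanish P)

  span⇒evaluate : ∀ {r} (b : X → Vector Carrier r) {es θ} → Span (monomials b) es θ →
    ∃ λ P → ∀ p → evaluate P (b p) ≈ᵍ θ p
  span⇒evaluate b ([] θ≈0) = [] , λ p → Q.sym (θ≈0 p)
  span⇒evaluate b {θ = θ} (_∷_ {k = e} u s) with span⇒evaluate b s
  ... | P , eq = (u , e) ∷ P , λ p → Q.trans (Q.+-congˡ {u * monomials b e p} (eq p))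
    (solve 2 (λ m t → m :+ (t :- m) := t) Q.refl (u * monomials b e p) (θ p))
    where open IntegerCoefficients quotientRing

  combination-evaluates : ∀ {r} (b : X → Vector Carrier r) w ρ ks n → let open Combinations (newtons b) w ρ in
    ∃ λ P → ∀ p → evaluate P (b p) ≈ᵍ combination ks n p
  combination-evaluates b w ρ ks n = span⇒evaluate b (proj₂ (combination-span ks n))
    where
    open Combinations (newtons b) w ρ

    combination-span : ∀ ks n → ∃ λ es → Span (monomials b) es (combination ks n)
    combination-span []       n = [] , [] λ _ → Q.refl
    combination-span (k ∷ ks) n = _ , span-++
      (span-* _ (proj₂ (newtons-span b k))) (proj₂ (combination-span ks _))

  combination-cong : ∀ {K : Set} {β : K → X → Carrier} w ρ {p p′} → let open Combinations β w ρ in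
    (∀ k → β k p ≈ᵍ β k p′) → ∀ ks n → combination ks n p ≈ᵍ combination ks n p′
  combination-cong w ρ eq []       n = Q.refl
  combination-cong w ρ eq (k ∷ ks) n = Q.+-cong (Q.*-congˡ (eq k)) (combination-cong w ρ eq ks _)

-- The count of polynomial functions.

module Counting {c ℓ₁ ℓ₂} (𝔽 : FiniteField c ℓ₁ ℓ₂) where

  open FiniteFieldPolynomials 𝔽
  open FiniteFieldLemmas 𝔽
  open Carlitz 𝔽 using (newton-∣)
  open GCDs 𝔽
  open Products F[t] using (prod-cong; prod-∣; ∏-prod; ∏-cong-∣; ∏-0)
  open Newton F[t] a
  open Algebra.Properties.CommutativeSemigroup.Divisibility A.*-commutativeSemigroup using (∣ʳ-trans; ∣ʳ-respˡ-≈)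
  private module ∏ = Algebra.Properties.CommutativeMonoid.Sum A.*-commutativeMonoid

  factorial≈newton : ∀ k → factorial k ≈ newton k (a k)
  factorial≈newton k = ∏-prod (λ j → a k - a j) k

  newton-cong : ∀ k {x y} → x ≈ y → newton k x ≈ newton k y
  newton-cong k x≈y = prod-cong k λ j → A.+-congʳ { - a j} x≈y

  factorial-∣ : ∀ k x → factorial k ∣ newton k x
  factorial-∣ k x = ∣ʳ-respˡ-≈ {newton k x} {newton k (a k)} {factorial k} (A.sym (factorial≈newton k)) (newton-∣ k x)

  ⊓-split : ∀ m n {o} → m ℕ.⊓ n ℕ.≤ o → m ℕ.≤ o ⊎ n ℕ.≤ o
  ⊓-split m n m⊓n≤o with ℕ.⊓-sel m n
  ... | inj₁ eq = inj₁ (≡.subst (ℕ._≤ _) eq m⊓n≤o)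
  ... | inj₂ eq = inj₂ (≡.subst (ℕ._≤ _) eq m⊓n≤o)

  -- If j is at least q ^ deg f, then `b`, whose number is smaller, is itself one of the roots. If j
  -- is at least l, then g divides `factorial l`, which divides `newton l b` by the key fact and so
  -- `newton j b`.
  newton-vanishes : ∀ (f g b : A) l j → deg b ℕ.< deg f → g ∣ factorial l →
                    q ℕ.^ deg f ℕ.≤ j ⊎ l ℕ.≤ j → g ∣ newton j b
  newton-vanishes f g b l j deg< g∣l! (inj₁ q^≤j) = 0# , A.trans (A.zeroˡ g) (A.sym (A.trans
    (newton-cong j (A.sym (a-number b)))
    (newton-root {j} {number b} (ℕ.<-≤-trans (number-< (deg f) b (deg<⇒vanishes b deg<)) q^≤j))))
  newton-vanishes f g b l j deg< g∣l! (inj₂ l≤j) =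
    ∣ʳ-trans {g} {newton l b} {newton j b}
      (∣ʳ-trans {g} {factorial l} {newton l b} g∣l! (factorial-∣ l b))
      (prod-∣ (λ i → b - a i) l≤j)

  multiFactorial : ∀ {r} → Vector ℕ r → A
  multiFactorial k = ∏ λ i → ∏ {k i} λ j → a (k i) - a (toℕ j)

  module _ {r} (f : Vector A r) (f-nc : ∀ i → NonConstant (f i)) (g : A) where

    Point : Set _
    Point = Setoid.Carrier (Residues f)

    coordinates : Point → Vector A r
    coordinates p i = proj₁ (p i)

    open Quotient F[t] g
    open QuotientSpans F[t] g a Point
    open Triangularity quotientRing Point
    open Spans quotientRing Point
    private module Q = CommutativeRing quotientRing

    basis : Vector ℕ r → Point → A
    basis = newtons coordinates

    multiFactorial-∣ : ∀ k p → multiFactorial k ∣ basis k p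
    multiFactorial-∣ k p = ∏-cong-∣ (λ i → factorial (k i)) (λ i → newton (k i) (proj₁ (p i)))
      λ i → factorial-∣ (k i) (proj₁ (p i))

    basis-cong : ∀ k {p p′ : Point} → (∀ i → proj₁ (p i) ≈ proj₁ (p′ i)) → basis k p ≈ᵍ basis k p′
    basis-cong k p≈p′ = ≈⇒≈ᵍ (∏.sum-cong-≋ {r} λ i → newton-cong (k i) (p≈p′ i))

    -- The count for any box and moduli with the properties that `μ` and `_/gcd_` supply.

    module _ (bound : Vector ℕ r) (bound≤ : ∀ i → bound i ℕ.≤ q ℕ.^ deg (f i))
             (vanish : NewtonsVanish coordinates bound)
             (modulus : Vector ℕ r → A) (modulus≉0 : ∀ k → ¬ modulus k ≈ 0#)
             (∣-modulus-* : ∀ k {z} → multiFactorial k ∣ z → g ∣ modulus k * z)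
             (modulus-∣ : ∀ k x → g ∣ x * multiFactorial k → modulus k ∣ x) where

      width : Vector ℕ r → ℕ
      width k = q ℕ.^ deg (modulus k)

      digit : ∀ k → Fin (width k) → A
      digit k i = a (toℕ i)

      open Combinations basis width digit

      reduce : ∀ (k : Vector ℕ r) (u : A) → ∃ λ i → ∀ p → digit k i * basis k p ≈ᵍ u * basis k p
      reduce k u = go (divide (modulus k) (deg (modulus k)) (deg-HasDegree (modulus k) (modulus≉0 k)) u)
        where
        go : Division (modulus k) (deg (modulus k)) u → _
        go (s , v , u≈ , v-small) = fromℕ< v< , λ p →
          Q.trans (Q.*-congʳ {basis k p} (≈⇒≈ᵍ digit≈v))
            (reduce-coefficient {u} {s} {modulus k} {v} {basis k p} u≈ (∣-modulus-* k (multiFactorial-∣ k p)))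
          where
          v< : number v ℕ.< width k
          v< = number-< (deg (modulus k)) v v-small
          digit≈v : a (toℕ (fromℕ< v<)) ≈ v
          digit≈v = A.trans (A.reflexive (≡.cong a (toℕ-fromℕ< v<))) (a-number v)

      InBox : Vector ℕ r → Set
      InBox k = ∀ i → k i ℕ.< bound i

      -- The cap `q ℕ.^ deg (f i)` on the box keeps each `a (k i)` among the residues of `f i`, so
      -- the evaluation points really lie in the domain.
      corner : (k : Vector ℕ r) → InBox k → Point
      corner k k< i = a (k i) , vanishes⇒deg< (a (k i)) (f-nc i) (a-vanishes (ℕ.<-≤-trans (k< i) (bound≤ i)))

      -- At its corner `basis k` equals `multiFactorial k`, so equal values make `modulus k` divide
      -- the difference of the digits. Both digits have degree below that of the modulus, or are
      -- zero, so the difference vanishes.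
      corner-separates : ∀ k (k< : InBox k) → Separates k (corner k k<)
      corner-separates k k< i j eq = Fin.toℕ-injective (a-injective (A.x∙y⁻¹≈ε⇒x≈y (digit k i) (digit k j)
        (small-∣⇒≈0 (modulus≉0 k) (modulus-∣ k (digit k i - digit k j)
          (difference-∣ {digit k i} {digit k j} {basis k (corner k k<)} {multiFactorial k}
            (A.sym (∏.sum-cong-≋ {r} λ i → factorial≈newton (k i))) eq)) small)))
        where
        small : VanishesFrom (deg (modulus k)) (digit k i - digit k j)
        small n deg≤n = F.trans (P.coeff-+ (digit k i) (- digit k j) n)
          (F.trans (F.+-cong (a-vanishes (Fin.toℕ<n i) n deg≤n)
                             (F.trans (P.coeff-neg (digit k j) n) (F.-‿cong (a-vanishes (Fin.toℕ<n j) n deg≤n))))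
                   (F.-‿inverseʳ F.0#))

      corner-kills : ∀ k (k< : InBox k) k′ → k ⊏ k′ → basis k′ (corner k k<) ≈ᵍ 0#
      corner-kills k k< k′ (i , k<k′) =
        ≈⇒≈ᵍ (∏-0 (λ i → newton (k′ i) (a (k i))) i (newton-root {k′ i} {k i} k<k′))

      box-triangular : Triangular basis Separates (box bound)
      box-triangular = triangular⁺ {_⊏_ = _⊏_} (box-sorted bound)
        (All.map (λ {k} k< → corner k k< , corner-separates k k< , corner-kills k k<) (box-bounded bound))

      polynomialFunction : Fin (size (box bound)) → Setoid.Carrier (PolynomialFunctions f g)
      polynomialFunction n =
        record { to   = combination (box bound) n
               ; cong = λ {p} {p′} p≈p′ → difference
                   (combination-cong width digit (λ k → basis-cong k {p} {p′} p≈p′) (box bound) n) } ,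
        proj₁ polynomial , λ b → difference (proj₂ polynomial b)
        where polynomial = combination-evaluates coordinates width digit (box bound) n

      polynomialFunctions-count : HasCardinality (PolynomialFunctions f g) (size (box bound))
      polynomialFunctions-count = record
        { to        = polynomialFunction
        ; cong      = λ { {n} ≡.refl → Setoid.refl (PolynomialFunctions f g) {polynomialFunction n} }
        ; bijective = (λ {m} {n} eq → combination-injective box-triangular m n λ p → mod (eq p)) , surjective
        }
        where
        surjective : ∀ φ → ∃ λ n → ∀ {m} → m ≡ n →
          Setoid._≈_ (PolynomialFunctions f g) (polynomialFunction m) φ
        surjective (φ , P , P≡φ) =
          let n , n≈P = span⇒combination reduce (evaluate-span coordinates bound vanish P) in
          n , λ { ≡.refl b → difference (Q.trans (n≈P b) (mod (P≡φ b))) }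

mainTheorem8 : ∀ {c ℓ₁ ℓ₂} (𝔽 : FiniteField c ℓ₁ ℓ₂) → let open FiniteFieldPolynomials 𝔽 in
    ∀ (r : ℕ) (f : Vector A r) (g : A) →
    (∀ i → NonConstant (f i)) → (g-nc : NonConstant g) →
    HasCardinality (PolynomialFunctions f g)
    (product (map (λ (k : Vector ℕ r) →
    q ℕ.^ deg (g /gcd (∏ λ i → ∏ {k i} λ j → a (k i) - a (toℕ j))))
    (box λ i → μ (f i) g g-nc)))
mainTheorem8 𝔽 r f g f-nc g-nc = polynomialFunctions-count f f-nc g
    (λ i → μ (f i) g g-nc) (λ i → ℕ.m⊓n≤m (q ℕ.^ deg (f i)) (lambda g g-nc))
    (λ i j μ≤j p → ∣⇒≈ᵍ0 (newton-vanishes (f i) g (proj₁ (p i)) (lambda g g-nc) j (proj₂ (p i))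
      (IsLambda.divides (lambda-isLambda g g-nc)) (⊓-split (q ℕ.^ deg (f i)) (lambda g g-nc) μ≤j)))
    (λ k → g /gcd multiFactorial k) (λ k → /gcd-≉0 (multiFactorial k) g≉0)
    (λ k → ∣-/gcd-* g) (λ k → /gcd-∣ (multiFactorial k) g≉0)
  where
  open FiniteFieldPolynomials 𝔽
  open GCDs 𝔽
  open Counting 𝔽
  open Quotient F[t] g using (∣⇒≈ᵍ0)
  g≉0 = NonConstant⇒≉0 g g-nc
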